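{- Suppose that $X \in 2^{\mathbb{N}}$ is random (in the sense of Martin-Löf). Then $X$ is normal; that is, for every $l$ and every bitstring $\sigma\in\{0,1\}^l$, $$\lim_{n\to\infty}\frac{\#\{\,i<n : \langle X(i),X(i+1),\dots,X(i+l-1)\rangle=\sigma\,\}}{n}=\frac{1}{2^l}.$$
   Context: $2^{\mathbb{N}}$ is the Cantor space of all total functions $X:\mathbb{N}\to\{0,1\}$ (infinite binary sequences, indexed from $0$). For a finite bitstring $\sigma$, $N_\sigma$ is the set of $X\in 2^{\mathbb{N}}$ having $\sigma$ as an initial segment, and $\mu$ is the unique Borel measure on $2^{\mathbb{N}}$ with $\mu(N_\sigma)=2^{ -|\sigma|}$ for every bitstring $\sigma$. $\varphi_e^{X}(x)$ denotes the output (if it halts) of the program with Gödel number $e$ on input $x$ with oracle $X$. The $\Sigma^0_1$ subsets of $2^{\mathbb{N}}$ are enumerated by $S_e=\{X\in 2^{\mathbb{N}}:\varphi_e^X(0)\downarrow\}$, where $\downarrow$ means "is defined". A sequence $(V_n)_{n\in\mathbb{N}}$ of $\Sigma^0_1$ sets is uniformly $\Sigma^0_1$ if there is a total recursive function $f$ with $V_n=S_{f(n)}$ for all $n$. A set $S\subseteq 2^{\mathbb{N}}$ is effectively null if $S\subseteq\bigcap_{n=0}^\infty V_n$ for some uniformly $\Sigma^0_1$ sequence $(V_n)$ with $\mu(V_n)\le 2^{ -n}$ for all $n$. A point $X\in 2^{\mathbb{N}}$ is random (in the sense of Martin-Löf) if it does not lie in any effectively null set. -}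

module Defs where

open import Data.Bool.Base using (Bool; true; false; if_then_else_)
import Data.Bool.Properties as Bool
open import Data.Fin.Base using (Fin; toℕ)
open import Data.Integer.Base using (+_)
open import Data.List.Base using (length; filter; upTo)
open import Data.Nat.Base using (ℕ; zero; suc; _+_; _*_; _^_; _≤_; _<_; NonZero)
open import Data.Nat.Properties using (m^n≢0)
open import Data.Product.Base using (∃; ∃-syntax; Σ-syntax; _×_; _,_)
open import Data.Rational.Base as ℚ using (ℚ; 0ℚ; _/_)
open import Data.Vec.Base using (Vec; []; _∷_; tabulate; lookup)
open import Data.Vec.Properties using (≡-dec)
open import Data.Vec.Relation.Binary.Pointwise.Inductive using (Pointwise)
open import Level using (0ℓ)
open import Relation.Binary.PropositionalEquality.Core using (_≡_)
open import Relation.Nullary.Negation.Core using (¬_)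
open import Relation.Unary using (Pred; _∈_; _⊆_; _≐_; ⋂)

Cantor : Set
Cantor = ℕ → Bool

Bitstring : Set
Bitstring = ∃ (Vec Bool)

∣_∣ : Bitstring → ℕ
∣ l , _ ∣ = l

-- ⟨ X(i) , X(i+1) , … , X(i+l-1) ⟩
window : Cantor → ℕ → (l : ℕ) → Vec Bool l
window X i l = tabulate (λ (j : Fin l) → X (i + toℕ j))

N : Bitstring → Pred Cantor 0ℓ
N (l , σ) X = window X 0 l ≡ σ

2^-_ : ℕ → ℚ
2^- k = _/_ (+ 1) (2 ^ k) {{m^n≢0 2 k}}

Σ[i<_]_ : ℕ → (ℕ → ℚ) → ℚ
Σ[i< zero  ] a = 0ℚ
Σ[i< suc k ] a = (Σ[i< k ] a) ℚ.+ a k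

-- μ is the measure obtained from μ(N σ) = 2^-|σ| by Carathéodory's extension:
-- on Borel sets it is the outer measure
--   μ(S) = inf { Σᵢ 2^-|σᵢ| : S ⊆ ⋃ᵢ N(σᵢ) },
-- the infimum being over sequences (σᵢ) of bitstrings.  As there is no type of
-- real numbers, μ is given through the relation  μ(S) ≤ r  for rational r;
-- Σᵢ 2^-|σᵢ| ≤ q means that all partial sums are ≤ q.
μ[_]≤_ : Pred Cantor 0ℓ → ℚ → Set
μ[ S ]≤ r = ∀ (ε : ℚ) → 0ℚ ℚ.< ε →
  Σ[ σ ∈ (ℕ → Bitstring) ]
    (∀ {X} → X ∈ S → ∃[ i ] X ∈ N (σ i))
    × (∀ k → (Σ[i< k ] λ i → 2^- ∣ σ i ∣) ℚ.≤ r ℚ.+ ε)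

-- Kleene's μ-recursive functions relative to an oracle.
data Program : ℕ → Set where
  zero   : ∀ {n} → Program n
  succ   : Program 1
  proj   : ∀ {n} → Fin n → Program n
  oracle : Program 1
  comp   : ∀ {m n} → Program m → Vec (Program n) m → Program n
  prec   : ∀ {n} → Program n → Program (2 + n) → Program (1 + n)
  min    : ∀ {n} → Program (1 + n) → Program n

bit : Bool → ℕ
bit b = if b then 1 else 0

infix 4 _⊢_[_]⇓_

data _⊢_[_]⇓_ (X : Cantor) : ∀ {n} → Program n → Vec ℕ n → ℕ → Set where
  zero   : ∀ {n} {xs : Vec ℕ n} → X ⊢ zero [ xs ]⇓ 0
  succ   : ∀ {x} → X ⊢ succ [ x ∷ [] ]⇓ suc x
  proj   : ∀ {n} {xs : Vec ℕ n} (i : Fin n) → X ⊢ proj i [ xs ]⇓ lookup xs i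
  oracle : ∀ {x} → X ⊢ oracle [ x ∷ [] ]⇓ bit (X x)
  comp   : ∀ {m n} {f : Program m} {gs : Vec (Program n) m} {xs ys z} →
           Pointwise (λ g y → X ⊢ g [ xs ]⇓ y) gs ys →
           X ⊢ f [ ys ]⇓ z →
           X ⊢ comp f gs [ xs ]⇓ z
  prec-0 : ∀ {n} {f : Program n} {g xs y} →
           X ⊢ f [ xs ]⇓ y →
           X ⊢ prec f g [ 0 ∷ xs ]⇓ y
  prec-+ : ∀ {n} {f : Program n} {g xs k y z} →
           X ⊢ prec f g [ k ∷ xs ]⇓ y →
           X ⊢ g [ k ∷ y ∷ xs ]⇓ z →
           X ⊢ prec f g [ suc k ∷ xs ]⇓ z
  min    : ∀ {n} {f : Program (1 + n)} {xs y} →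
           X ⊢ f [ y ∷ xs ]⇓ 0 →
           (∀ z → z < y → ∃[ w ] X ⊢ f [ z ∷ xs ]⇓ suc w) →
           X ⊢ min f [ xs ]⇓ y

-- Injective, since x ≤ x + y gives (x + y)² ≤ ⟪ x , y ⟫ < (x + y + 1)².
⟪_,_⟫ : ℕ → ℕ → ℕ
⟪ x , y ⟫ = (x + y) * (x + y) + x

mutual

  -- Gödel numbers; the numbering is injective on programs of a given arity.
  ⌜_⌝ : ∀ {n} → Program n → ℕ
  ⌜ zero ⌝            = ⟪ 0 , 0 ⟫
  ⌜ succ ⌝            = ⟪ 1 , 0 ⟫
  ⌜ proj i ⌝          = ⟪ 2 , toℕ i ⟫
  ⌜ oracle ⌝          = ⟪ 3 , 0 ⟫
  ⌜ comp {m} f gs ⌝   = ⟪ 4 , ⟪ m , ⟪ ⌜ f ⌝ , ⌜ gs ⌝* ⟫ ⟫ ⟫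
  ⌜ prec f g ⌝        = ⟪ 5 , ⟪ ⌜ f ⌝ , ⌜ g ⌝ ⟫ ⟫
  ⌜ min f ⌝           = ⟪ 6 , ⌜ f ⌝ ⟫

  ⌜_⌝* : ∀ {m n} → Vec (Program n) m → ℕ
  ⌜ [] ⌝*     = 0
  ⌜ g ∷ gs ⌝* = ⟪ ⌜ g ⌝ , ⌜ gs ⌝* ⟫

-- φ e ^ X [ x ]≃ y : φₑˣ(x) is defined and equal to y.  A number e which is not
-- a Gödel number names the nowhere defined function.
φ_^_[_]≃_ : ℕ → Cantor → ℕ → ℕ → Set
φ e ^ X [ x ]≃ y = Σ[ p ∈ Program 1 ] ⌜ p ⌝ ≡ e × X ⊢ p [ x ∷ [] ]⇓ y

φ_^_[_]↓ : ℕ → Cantor → ℕ → Set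
φ e ^ X [ x ]↓ = ∃[ y ] φ e ^ X [ x ]≃ y

-- Absolute computability is computability with the empty oracle.
TotalRecursive : (ℕ → ℕ) → Set
TotalRecursive f = ∃[ e ] ∀ n → φ e ^ (λ _ → false) [ n ]≃ f n

S : ℕ → Pred Cantor 0ℓ
S e X = φ e ^ X [ 0 ]↓

UniformlyΣ⁰₁ : (ℕ → Pred Cantor 0ℓ) → Set
UniformlyΣ⁰₁ V = Σ[ f ∈ (ℕ → ℕ) ] TotalRecursive f × (∀ n → V n ≐ S (f n))

EffectivelyNull : Pred Cantor 0ℓ → Set₁
EffectivelyNull A = Σ[ V ∈ (ℕ → Pred Cantor 0ℓ) ]
  UniformlyΣ⁰₁ V × (∀ n → μ[ V n ]≤ (2^- n)) × A ⊆ ⋂ ℕ V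

Random : Cantor → Set₁
Random X = ∀ A → EffectivelyNull A → ¬ X ∈ A

occurrences : ∀ {l} → Cantor → Vec Bool l → ℕ → ℕ
occurrences {l} X σ n =
  length (filter (λ i → ≡-dec Bool._≟_ (window X i l) σ) (upTo n))

frequency : ∀ {l} → Cantor → Vec Bool l → (n : ℕ) .{{_ : NonZero n}} → ℚ
frequency X σ n = + occurrences X σ n / n

-- Convergence of a sequence of rationals indexed by the positive integers.
infix 4 _⟶_
_⟶_ : ((n : ℕ) .{{_ : NonZero n}} → ℚ) → ℚ → Set
a ⟶ L = ∀ (ε : ℚ) → 0ℚ ℚ.< ε →
  ∃[ n₀ ] ∀ n .{{_ : NonZero n}} → n₀ ≤ n → ℚ.∣ a n ℚ.- L ∣ ℚ.< ε

Normal : Cantor → Set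
Normal X = ∀ l (σ : Vec Bool l) → frequency X σ ⟶ (2^- l)

{-# OPTIONS --safe #-}

-- If some word ρ is followed by the bit b noticeably more often than by its
-- complement, then betting a small fraction 1/(1+e) of the capital on b after each
-- occurrence of ρ yields unbounded capital.  The capital is a computable martingale,
-- so by Ville's inequality the sets {Y : the capital along Y reaches 2^n} form a
-- Martin-Löf test, and a random X makes the capital bounded for every ρ, b and e.
-- Hence each word is followed by 0 and by 1 with asymptotically equal frequency, and
-- the density of a word of length l is 2^-l by induction on l.
module Submission where

open import Defs
open import Axiom.ExcludedMiddle using (ExcludedMiddle)
open import Level using (0ℓ)
open import Data.Bool.Base using (Bool; true; false; not; if_then_else_; _∧_)
import Data.Bool.Properties as Bool
open import Data.Empty using (⊥-elim)
open import Data.Fin.Base using (toℕ; zero; suc)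
open import Data.Fin.Properties using (toℕ-injective; toℕ<n)
import Data.Integer.Base as ℤ
import Data.Integer.Properties as ℤ
open import Data.List.Base using (List; []; _∷_; _++_; length; filter; upTo)
open import Data.List.Properties using (++-assoc; upTo-∷ʳ; filter-++; length-++)
open import Data.Nat.Base hiding (_/_)
open import Data.Nat.Properties
open import Data.Nat.Solver using (module +-*-Solver)
open import Data.Product.Base using (∃-syntax; _×_; _,_; proj₁; proj₂)
open import Data.Rational.Base as ℚ using (ℚ; 0ℚ; _/_)
import Data.Rational.Properties as ℚ
import Data.Rational.Solver as ℚ-Solver
open import Data.Rational.Unnormalised.Base as ℚᵘ using (mkℚᵘ; *≤*; *<*)
import Data.Rational.Unnormalised.Properties as ℚᵘ
open import Data.Sum.Base using (inj₁; inj₂)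
open import Data.Vec.Base using (Vec; []; _∷_; replicate)
open import Data.Vec.Properties using (tabulate-cong; ≡-dec)
open import Data.Vec.Relation.Binary.Pointwise.Inductive using (Pointwise; []; _∷_)
open import Relation.Binary.Definitions using (tri<; tri≈; tri>)
open import Relation.Binary.PropositionalEquality
open import Relation.Nullary.Decidable.Core using (yes; no; does)
open import Relation.Nullary.Negation.Core using (¬_; contradiction)
open import Relation.Unary using (Pred; Decidable)

-- Injectivity of the Gödel numbering

-- Why a small fraction of the capital is bet: a win and a loss together multiply the capital by
-- e(2+e)/(1+e)² = 1 - 1/(1+e)², a loss of second order, while a surplus win gains the factor 1 +
-- 1/(1+e). One surplus win thus outweighs e such pairs, and bounded capital forces e * wins ≤ (e +
-- 1) * losses + constant. Large e, and bets on either bit, give equal frequencies. The formal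
-- notions shape the rest. A measure bound is an explicit cover by cylinders, so Ville's inequality
-- has to construct one. Σ⁰₁ sets and recursive functions are given by programs, so the capital,
-- scaled to a natural number, has to be programmed and the codes of the test sets computed.
-- Membership in `S e` provides only some program with code `e`, hence the injectivity of the
-- numbering.

⟪⟫-< : ∀ {x y u v} → x + y < u + v → ⟪ x , y ⟫ < ⟪ u , v ⟫
⟪⟫-< {x} {y} {u} {v} s<t = begin-strict
  (x + y) * (x + y) + x            ≤⟨ +-monoʳ-≤ ((x + y) * (x + y)) (m≤m+n x y) ⟩
  (x + y) * (x + y) + (x + y)      ≡⟨ +-comm ((x + y) * (x + y)) (x + y) ⟩
  suc (x + y) * (x + y)            <⟨ *-monoʳ-< (suc (x + y)) (n<1+n (x + y)) ⟩
  suc (x + y) * suc (x + y)        ≤⟨ *-mono-≤ s<t s<t ⟩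
  (u + v) * (u + v)                ≤⟨ m≤m+n _ u ⟩
  (u + v) * (u + v) + u            ∎
  where open ≤-Reasoning

⟪⟫-injective : ∀ x y u v → ⟪ x , y ⟫ ≡ ⟪ u , v ⟫ → x ≡ u × y ≡ v
⟪⟫-injective x y u v eq with <-cmp (x + y) (u + v)
... | tri< s<t _ _ = contradiction eq (<⇒≢ (⟪⟫-< {x} {y} {u} {v} s<t))
... | tri> _ _ t<s = contradiction (sym eq) (<⇒≢ (⟪⟫-< {u} {v} {x} {y} t<s))
... | tri≈ _ s≡t _ = x≡u , +-cancelˡ-≡ u y v (trans (cong (_+ y) (sym x≡u)) s≡t)
  where
  x≡u : x ≡ u
  x≡u = +-cancelˡ-≡ ((u + v) * (u + v)) x u (trans (cong (λ s → s * s + x) (sym s≡t)) eq)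

private
  tag body : ∀ {n} → Program n → ℕ
  tag zero       = 0
  tag succ       = 1
  tag (proj _)   = 2
  tag oracle     = 3
  tag (comp _ _) = 4
  tag (prec _ _) = 5
  tag (min _)    = 6
  body zero              = 0
  body succ              = 0
  body (proj i)          = toℕ i
  body oracle            = 0
  body (comp {m} f gs)   = ⟪ m , ⟪ ⌜ f ⌝ , ⌜ gs ⌝* ⟫ ⟫
  body (prec f g)        = ⟪ ⌜ f ⌝ , ⌜ g ⌝ ⟫
  body (min f)           = ⌜ f ⌝

  ⌜⌝-split : ∀ {n} (p : Program n) → ⌜ p ⌝ ≡ ⟪ tag p , body p ⟫
  ⌜⌝-split zero       = refl
  ⌜⌝-split succ       = refl
  ⌜⌝-split (proj _)   = refl
  ⌜⌝-split oracle     = refl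
  ⌜⌝-split (comp _ _) = refl
  ⌜⌝-split (prec _ _) = refl
  ⌜⌝-split (min _)    = refl

  -- Every code is a pair of tag and body, so a single use of `⟪⟫-injective` serves all
  -- constructors. In `go` the tag equation between different constructors is absurd, and only the
  -- diagonal clauses remain.
  ⌜⌝-components : ∀ {n} (p q : Program n) → ⌜ p ⌝ ≡ ⌜ q ⌝ → tag p ≡ tag q × body p ≡ body q
  ⌜⌝-components p q eq = ⟪⟫-injective _ (body p) _ (body q) (trans (sym (⌜⌝-split p)) (trans eq (⌜⌝-split q)))

mutual
  ⌜⌝-injective : ∀ {n} (p q : Program n) → ⌜ p ⌝ ≡ ⌜ q ⌝ → p ≡ q
  ⌜⌝-injective p q eq = let (t , b) = ⌜⌝-components p q eq in go p q t b
    where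
    go : ∀ {n} (p q : Program n) → tag p ≡ tag q → body p ≡ body q → p ≡ q
    go zero zero _ _ = refl
    go succ succ _ _ = refl
    go (proj i) (proj j) _ b = cong proj (toℕ-injective b)
    go oracle oracle _ _ = refl
    go (comp {m} f gs) (comp {m′} f′ gs′) _ b
      -- `comp` hides the arity `m`; only once it has been read off the code do `f` and `f′`, and
      -- the two vectors, have the same type.
      with ⟪⟫-injective m ⟪ ⌜ f ⌝ , ⌜ gs ⌝* ⟫ m′ ⟪ ⌜ f′ ⌝ , ⌜ gs′ ⌝* ⟫ b
    ... | refl , b′ with ⟪⟫-injective ⌜ f ⌝ ⌜ gs ⌝* ⌜ f′ ⌝ ⌜ gs′ ⌝* b′
    ...   | c , d = cong₂ comp (⌜⌝-injective f f′ c) (⌜⌝*-injective gs gs′ d)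
    go (prec f g) (prec f′ g′) _ b with ⟪⟫-injective ⌜ f ⌝ ⌜ g ⌝ ⌜ f′ ⌝ ⌜ g′ ⌝ b
    ... | c , d = cong₂ prec (⌜⌝-injective f f′ c) (⌜⌝-injective g g′ d)
    go (min f) (min f′) _ b = cong min (⌜⌝-injective f f′ b)

  ⌜⌝*-injective : ∀ {m n} (ps qs : Vec (Program n) m) → ⌜ ps ⌝* ≡ ⌜ qs ⌝* → ps ≡ qs
  ⌜⌝*-injective [] [] _ = refl
  ⌜⌝*-injective (p ∷ ps) (q ∷ qs) eq with ⟪⟫-injective ⌜ p ⌝ ⌜ ps ⌝* ⌜ q ⌝ ⌜ qs ⌝* eq
  ... | c , d = cong₂ _∷_ (⌜⌝-injective p q c) (⌜⌝*-injective ps qs d)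

mutual
  ⇓-deterministic : ∀ {X n} {p : Program n} {xs y z} →
                    X ⊢ p [ xs ]⇓ y → X ⊢ p [ xs ]⇓ z → y ≡ z
  ⇓-deterministic zero zero = refl
  ⇓-deterministic succ succ = refl
  ⇓-deterministic (proj i) (proj .i) = refl
  ⇓-deterministic oracle oracle = refl
  ⇓-deterministic (comp gs f) (comp gs′ f′) with ⇓*-deterministic gs gs′
  ... | refl = ⇓-deterministic f f′
  ⇓-deterministic (prec-0 f) (prec-0 f′) = ⇓-deterministic f f′
  ⇓-deterministic (prec-+ r g) (prec-+ r′ g′) with ⇓-deterministic r r′
  ... | refl = ⇓-deterministic g g′
  ⇓-deterministic {y = y} {z} (min f below) (min f′ below′) with <-cmp y z
  ... | tri≈ _ y≡z _ = y≡z
  ... | tri< y<z _ _ = contradiction (⇓-deterministic f (proj₂ (below′ y y<z))) λ ()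
  ... | tri> _ _ z<y = contradiction (⇓-deterministic f′ (proj₂ (below z z<y))) λ ()

  ⇓*-deterministic : ∀ {X m n} {gs : Vec (Program n) m} {xs ys zs} →
                     Pointwise (λ g y → X ⊢ g [ xs ]⇓ y) gs ys →
                     Pointwise (λ g y → X ⊢ g [ xs ]⇓ y) gs zs → ys ≡ zs
  ⇓*-deterministic [] [] = refl
  ⇓*-deterministic (d ∷ ds) (e ∷ es) = cong₂ _∷_ (⇓-deterministic d e) (⇓*-deterministic ds es)

-- Programs

⇓-cong : ∀ {X n} {p : Program n} {xs y z} → y ≡ z → X ⊢ p [ xs ]⇓ y → X ⊢ p [ xs ]⇓ z
⇓-cong refl d = d

module _ {X : Cantor} where

  comp₁-⇓ : ∀ {n} {f : Program 1} {g : Program n} {xs y z} →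
            X ⊢ g [ xs ]⇓ y → X ⊢ f [ y ∷ [] ]⇓ z → X ⊢ comp f (g ∷ []) [ xs ]⇓ z
  comp₁-⇓ g f = comp (g ∷ []) f

  comp₂-⇓ : ∀ {n} {f : Program 2} {g h : Program n} {xs y z w} →
            X ⊢ g [ xs ]⇓ y → X ⊢ h [ xs ]⇓ z → X ⊢ f [ y ∷ z ∷ [] ]⇓ w →
            X ⊢ comp f (g ∷ h ∷ []) [ xs ]⇓ w
  comp₂-⇓ g h f = comp (g ∷ h ∷ []) f

constant : ∀ {n} → ℕ → Program n
constant zero    = zero
constant (suc k) = comp succ (constant k ∷ [])

constant-⇓ : ∀ {X n} {xs : Vec ℕ n} k → X ⊢ constant k [ xs ]⇓ k
constant-⇓ zero    = zero
constant-⇓ (suc k) = comp₁-⇓ (constant-⇓ k) succ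

predecessor : Program 1
predecessor = prec zero (proj zero)

-- `prec` recurses on its first argument, whereas `_^_` and `_∸_` recurse on their second; hence the
-- swapped arguments in `power` and `monus`.
add mul power monus pair : Program 2
add   = prec (proj zero) (comp succ (proj (suc zero) ∷ []))
mul   = prec zero (comp add (proj (suc (suc zero)) ∷ proj (suc zero) ∷ []))
power = comp powerFlipped (proj (suc zero) ∷ proj zero ∷ [])
  where
  powerFlipped : Program 2
  powerFlipped = prec (constant 1) (comp mul (proj (suc (suc zero)) ∷ proj (suc zero) ∷ []))
monus = comp monusFlipped (proj (suc zero) ∷ proj zero ∷ [])
  where
  monusFlipped : Program 2
  monusFlipped = prec (proj zero) (comp predecessor (proj (suc zero) ∷ []))
pair  = comp add (comp mul (sum ∷ sum ∷ []) ∷ proj zero ∷ [])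
  where
  sum : Program 2
  sum = comp add (proj zero ∷ proj (suc zero) ∷ [])

conditional : Program 3
conditional = prec (proj (suc zero)) (proj (suc (suc zero)))

module _ {X : Cantor} where

  add-⇓ : ∀ x y → X ⊢ add [ x ∷ y ∷ [] ]⇓ x + y
  add-⇓ zero    y = prec-0 (proj zero)
  add-⇓ (suc x) y = prec-+ (add-⇓ x y) (comp₁-⇓ (proj (suc zero)) succ)

  mul-⇓ : ∀ x y → X ⊢ mul [ x ∷ y ∷ [] ]⇓ x * y
  mul-⇓ zero    y = prec-0 zero
  mul-⇓ (suc x) y = prec-+ (mul-⇓ x y) (comp₂-⇓ (proj (suc (suc zero))) (proj (suc zero)) (add-⇓ y (x * y)))

  power-⇓ : ∀ x y → X ⊢ power [ x ∷ y ∷ [] ]⇓ x ^ y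
  power-⇓ x y = comp₂-⇓ (proj (suc zero)) (proj zero) (go y)
    where
    go : ∀ y → X ⊢ _ [ y ∷ x ∷ [] ]⇓ x ^ y
    go zero    = prec-0 (constant-⇓ 1)
    go (suc y) = prec-+ (go y) (comp₂-⇓ (proj (suc (suc zero))) (proj (suc zero)) (mul-⇓ x (x ^ y)))

  predecessor-⇓ : ∀ x → X ⊢ predecessor [ x ∷ [] ]⇓ pred x
  predecessor-⇓ zero    = prec-0 zero
  predecessor-⇓ (suc x) = prec-+ (predecessor-⇓ x) (proj zero)

  monus-⇓ : ∀ x y → X ⊢ monus [ x ∷ y ∷ [] ]⇓ x ∸ y
  monus-⇓ x y = comp₂-⇓ (proj (suc zero)) (proj zero) (go y)
    where
    go : ∀ y → X ⊢ _ [ y ∷ x ∷ [] ]⇓ x ∸ y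
    go zero    = prec-0 (proj zero)
    go (suc y) = prec-+ (go y) (comp₁-⇓ (proj (suc zero))
      (⇓-cong (pred[m∸n]≡m∸[1+n] x y) (predecessor-⇓ (x ∸ y))))

  pair-⇓ : ∀ x y → X ⊢ pair [ x ∷ y ∷ [] ]⇓ ⟪ x , y ⟫
  pair-⇓ x y = comp₂-⇓ (comp₂-⇓ sum-⇓ sum-⇓ (mul-⇓ (x + y) (x + y))) (proj zero) (add-⇓ _ x)
    where
    sum-⇓ : X ⊢ _ [ x ∷ y ∷ [] ]⇓ (x + y)
    sum-⇓ = comp₂-⇓ (proj zero) (proj (suc zero)) (add-⇓ x y)

  conditional-⇓ : ∀ b x y → X ⊢ conditional [ bit b ∷ x ∷ y ∷ [] ]⇓ (if b then x else y)
  conditional-⇓ false x y = prec-0 (proj (suc zero))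
  conditional-⇓ true  x y = prec-+ (prec-0 (proj (suc zero))) (proj (suc (suc zero)))

-- An instance of the s-m-n theorem: `n` is compiled into the program as a numeral, and the code of
-- the result is obtained from `⌜ p ⌝` and `n` by iterated pairing.
totalRecursive-specialise : (p : Program 1) → TotalRecursive (λ n → ⌜ comp p (constant {1} n ∷ []) ⌝)
totalRecursive-specialise p = ⌜ program ⌝ , λ n → program , refl , program-⇓ n
  where
  compNumber : ℕ → ℕ → ℕ
  compNumber f g = ⟪ 4 , ⟪ 1 , ⟪ f , ⟪ g , 0 ⟫ ⟫ ⟫ ⟫

  compProgram : Program 2
  compProgram =
    comp pair (constant 4 ∷ comp pair (constant 1 ∷ comp pair (proj zero ∷
      comp pair (proj (suc zero) ∷ zero ∷ []) ∷ []) ∷ []) ∷ [])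

  compProgram-⇓ : ∀ {X} f g → X ⊢ compProgram [ f ∷ g ∷ [] ]⇓ compNumber f g
  compProgram-⇓ f g =
    comp₂-⇓ (constant-⇓ 4) (comp₂-⇓ (constant-⇓ 1) (comp₂-⇓ (proj zero)
      (comp₂-⇓ (proj (suc zero)) zero (pair-⇓ g 0)) (pair-⇓ f _)) (pair-⇓ 1 _)) (pair-⇓ 4 _)

  -- The base case is right because `⌜ zero ⌝`, that is `⟪ 0 , 0 ⟫`, computes to 0.
  constantNumber : Program 1
  constantNumber = prec zero (comp compProgram (constant ⌜ succ ⌝ ∷ proj (suc zero) ∷ []))

  constantNumber-⇓ : ∀ {X} n → X ⊢ constantNumber [ n ∷ [] ]⇓ ⌜ constant {1} n ⌝
  constantNumber-⇓ zero    = prec-0 zero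
  constantNumber-⇓ (suc n) = prec-+ (constantNumber-⇓ n)
    (comp₂-⇓ (constant-⇓ ⌜ succ ⌝) (proj (suc zero)) (compProgram-⇓ ⌜ succ ⌝ _))

  program : Program 1
  program = comp compProgram (constant ⌜ p ⌝ ∷ constantNumber ∷ [])

  program-⇓ : ∀ {X} n → X ⊢ program [ n ∷ [] ]⇓ ⌜ comp p (constant {1} n ∷ []) ⌝
  program-⇓ n = comp₂-⇓ (constant-⇓ ⌜ p ⌝) (constantNumber-⇓ n) (compProgram-⇓ ⌜ p ⌝ _)

-- Membership in a test set provides some root, but the rule for `min` demands a root with positive
-- values below it.
leastZero : ∀ (g : ℕ → ℕ) m → g m ≡ 0 → ∃[ y ] g y ≡ 0 × (∀ z → z < y → ∃[ w ] g z ≡ suc w)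
leastZero g m gm with g 0 in g0
... | zero  = 0 , g0 , λ z ()
leastZero g zero gm | suc _ with () ← trans (sym gm) g0
leastZero g (suc m) gm | suc w with leastZero (λ i → g (suc i)) m gm
... | y , gy , below = suc y , gy , λ { zero _ → w , g0 ; (suc z) (s≤s z<y) → below z z<y }

module _ (h : Program 2) (G : Cantor → ℕ → ℕ → ℕ)
         (h-⇓ : ∀ X m n → X ⊢ h [ m ∷ n ∷ [] ]⇓ G X m n) where

  private
    search : ℕ → Program 1
    search n = comp (min h) (constant n ∷ [])

    search-complete : ∀ X n m → G X m n ≡ 0 → ∃[ y ] X ⊢ search n [ 0 ∷ [] ]⇓ y
    search-complete X n m gm with leastZero (λ i → G X i n) m gm
    ... | y , gy , below = y , comp₁-⇓ (constant-⇓ n)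
      (min (⇓-cong gy (h-⇓ X y n))
           (λ z z<y → let (w , gz) = below z z<y in w , ⇓-cong gz (h-⇓ X z n)))

    search-sound : ∀ X n {y} → X ⊢ search n [ 0 ∷ [] ]⇓ y → G X y n ≡ 0
    search-sound X n (comp (c ∷ []) (min f _)) with ⇓-deterministic c (constant-⇓ n)
    ... | refl = ⇓-deterministic (h-⇓ X _ n) f

  uniformlyΣ⁰₁-search : UniformlyΣ⁰₁ (λ n X → ∃[ m ] G X m n ≡ 0)
  uniformlyΣ⁰₁-search = (λ n → ⌜ search n ⌝) , totalRecursive-specialise (min h) , λ n →
    (λ {X} (m , gm) → let (y , d) = search-complete X n m gm in y , search n , refl , d) ,
    -- The halting program `p` is known only through its code; injectivity identifies it with
    -- `search n`, whose run yields a root.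
    λ {X} (y , p , eq , d) → y , search-sound X n
      (subst (X ⊢_[ 0 ∷ [] ]⇓ y) (⌜⌝-injective p (search n) eq) d)

-- Fractions and powers of two

-- `_/_` cancels common factors; passing to unnormalised rationals reduces order and sums to
-- cross-multiplication of natural numbers.
toℚᵘ-/ : ∀ a d → ℚ.toℚᵘ (ℤ.+ a / suc d) ℚᵘ.≃ mkℚᵘ (ℤ.+ a) d
toℚᵘ-/ a d = ℚ.toℚᵘ-fromℚᵘ (mkℚᵘ (ℤ.+ a) d)

/-mono-≤ : ∀ a b c d .{{_ : NonZero b}} .{{_ : NonZero d}} →
           a * d ≤ c * b → ℤ.+ a / b ℚ.≤ ℤ.+ c / d
/-mono-≤ a (suc b) c (suc d) ad≤cb = ℚ.toℚᵘ-cancel-≤ (begin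
  ℚ.toℚᵘ (ℤ.+ a / suc b)  ≃⟨ toℚᵘ-/ a b ⟩
  mkℚᵘ (ℤ.+ a) b          ≤⟨ *≤* (subst₂ ℤ._≤_ (ℤ.pos-* a (suc d)) (ℤ.pos-* c (suc b)) (ℤ.+≤+ ad≤cb)) ⟩
  mkℚᵘ (ℤ.+ c) d          ≃⟨ toℚᵘ-/ c d ⟨
  ℚ.toℚᵘ (ℤ.+ c / suc d)  ∎)
  where open ℚᵘ.≤-Reasoning

/-mono-< : ∀ a b c d .{{_ : NonZero b}} .{{_ : NonZero d}} →
           a * d < c * b → ℤ.+ a / b ℚ.< ℤ.+ c / d
/-mono-< a (suc b) c (suc d) ad<cb = ℚ.toℚᵘ-cancel-< (begin-strict
  ℚ.toℚᵘ (ℤ.+ a / suc b)  ≃⟨ toℚᵘ-/ a b ⟩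
  mkℚᵘ (ℤ.+ a) b          <⟨ *<* (subst₂ ℤ._<_ (ℤ.pos-* a (suc d)) (ℤ.pos-* c (suc b)) (ℤ.+<+ ad<cb)) ⟩
  mkℚᵘ (ℤ.+ c) d          ≃⟨ toℚᵘ-/ c d ⟨
  ℚ.toℚᵘ (ℤ.+ c / suc d)  ∎)
  where open ℚᵘ.≤-Reasoning

/-cong-≡ : ∀ a b c d .{{_ : NonZero b}} .{{_ : NonZero d}} →
           a * d ≡ c * b → ℤ.+ a / b ≡ ℤ.+ c / d
/-cong-≡ a b c d eq = ℚ.≤-antisym (/-mono-≤ a b c d (≤-reflexive eq)) (/-mono-≤ c d a b (≤-reflexive (sym eq)))

/-+ : ∀ a b c d .{{_ : NonZero b}} .{{_ : NonZero d}} .{{_ : NonZero (b * d)}} →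
      ℤ.+ a / b ℚ.+ ℤ.+ c / d ≡ ℤ.+ (a * d + c * b) / (b * d)
/-+ a (suc b) c (suc d) = ℚ.toℚᵘ-injective (begin
  ℚ.toℚᵘ (ℤ.+ a / suc b ℚ.+ ℤ.+ c / suc d)             ≈⟨ ℚ.toℚᵘ-homo-+ (ℤ.+ a / suc b) (ℤ.+ c / suc d) ⟩
  ℚ.toℚᵘ (ℤ.+ a / suc b) ℚᵘ.+ ℚ.toℚᵘ (ℤ.+ c / suc d)  ≈⟨ ℚᵘ.+-cong (toℚᵘ-/ a b) (toℚᵘ-/ c d) ⟩
  mkℚᵘ (ℤ.+ a) b ℚᵘ.+ mkℚᵘ (ℤ.+ c) d                   ≡⟨ cong (λ i → mkℚᵘ i (d + b * suc d))
                                                            (sym (cong₂ ℤ._+_ (ℤ.pos-* a (suc d)) (ℤ.pos-* c (suc b)))) ⟩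
  mkℚᵘ (ℤ.+ (a * suc d + c * suc b)) (d + b * suc d)    ≈⟨ toℚᵘ-/ (a * suc d + c * suc b) (d + b * suc d) ⟨
  ℚ.toℚᵘ (ℤ.+ (a * suc d + c * suc b) / (suc b * suc d)) ∎)
  where open ℚᵘ.≃-Reasoning

/-nonNegative : ∀ a b .{{_ : NonZero b}} → 0ℚ ℚ.≤ ℤ.+ a / b
/-nonNegative a b = /-mono-≤ 0 1 a b z≤n

2^-≥0 : ∀ k → 0ℚ ℚ.≤ 2^- k
2^-≥0 k = /-nonNegative 1 (2 ^ k) {{m^n≢0 2 k}}

2^-halves : ∀ k → 2^- suc k ℚ.+ 2^- suc k ≡ 2^- k
2^-halves k = trans (/-+ 1 q 1 q) (/-cong-≡ (1 * q + 1 * q) (q * q) 1 p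
  (solve 1 (λ p → (con 1 :* (con 2 :* p) :+ con 1 :* (con 2 :* p)) :* p
       := con 1 :* ((con 2 :* p) :* (con 2 :* p))) refl p))
  where
  open +-*-Solver
  p q : ℕ
  p = 2 ^ k
  q = 2 * p
  instance
    p≢0 : NonZero p
    p≢0 = m^n≢0 2 k
    q≢0 : NonZero q
    q≢0 = m^n≢0 2 (suc k)
    q*q≢0 : NonZero (q * q)
    q*q≢0 = m*n≢0 q q

n<2^n : ∀ n → n < 2 ^ n
n<2^n zero    = s≤s z≤n
n<2^n (suc n) = begin-strict
  suc n            ≤⟨ n<2^n n ⟩
  2 ^ n            <⟨ m<m+n (2 ^ n) (m^n>0 2 n) ⟩
  2 ^ n + 2 ^ n    ≡⟨ cong (2 ^ n +_) (sym (+-identityʳ (2 ^ n))) ⟩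
  2 ^ suc n        ∎
  where open ≤-Reasoning

-- The numerator of a positive rational is at least 1. Its denominator therefore serves wherever a
-- natural number has to be chosen in terms of `ε`.
1/denominator≤ : ∀ {ε} → 0ℚ ℚ.< ε → ℤ.+ 1 / ℚ.↧ₙ ε ℚ.≤ ε
1/denominator≤ {ε} 0<ε with ε in eq | 0<ε
... | ℚ.mkℚ (ℤ.+ suc a) d c | _ = subst (ℤ.+ 1 / suc d ℚ.≤_) (ℚ.fromℚᵘ-toℚᵘ _)
        (/-mono-≤ 1 (suc d) (suc a) (suc d) (*-monoˡ-≤ (suc d) {1} {suc a} (s≤s z≤n)))
... | ℚ.mkℚ (ℤ.+ zero) d c | ℚ.*<* (ℤ.+<+ ())
... | ℚ.mkℚ ℤ.-[1+ a ] d c | ℚ.*<* ()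

2^-denominator≤ : ∀ {ε} → 0ℚ ℚ.< ε → 2^- ℚ.↧ₙ ε ℚ.≤ ε
2^-denominator≤ {ε} 0<ε = ℚ.≤-trans
  (/-mono-≤ 1 (2 ^ ℚ.↧ₙ ε) 1 (ℚ.↧ₙ ε) {{m^n≢0 2 (ℚ.↧ₙ ε)}} (*-monoʳ-≤ 1 (<⇒≤ (n<2^n (ℚ.↧ₙ ε)))))
  (1/denominator≤ 0<ε)

-- Cylinders and coverings

Agree : ℕ → Cantor → Cantor → Set
Agree m Y Z = ∀ i → i < m → Y i ≡ Z i

_[_≔_] : Cantor → ℕ → Bool → Cantor
(Y [ m ≔ a ]) i with i ≟ m
... | yes _ = a
... | no  _ = Y i

≔-at : ∀ Y m a → (Y [ m ≔ a ]) m ≡ a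
≔-at Y m a with m ≟ m
... | yes _   = refl
... | no  m≢m = contradiction refl m≢m

≔-below : ∀ Y m a → Agree m (Y [ m ≔ a ]) Y
≔-below Y m a i i<m with i ≟ m
... | yes i≡m = contradiction i≡m (<⇒≢ i<m)
... | no  _   = refl

agree-≔ : ∀ {m Y Z} → Agree m Y Z → Agree (suc m) Y (Z [ m ≔ Y m ])
agree-≔ {m} {Y} {Z} Y~Z i i≤m with i ≟ m
... | yes refl = refl
... | no  i≢m  = Y~Z i (≤∧≢⇒< (s≤s⁻¹ i≤m) i≢m)

agree⇒∈N : ∀ {m Y Z} → Agree m Y Z → N (m , window Z 0 m) Y
agree⇒∈N Y~Z = tabulate-cong (λ j → Y~Z (toℕ j) (toℕ<n j))

-- Ville's inequality for a nonnegative supermartingale, W Y m being 2^-m times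
-- the capital after the first m bits of Y.  A cover of the set of successful Y is
-- found by breadth-first search: a string that succeeds is output and otherwise
-- replaced by its two children, so the total W of the queue pays for the output.
-- A step that outputs nothing emits a long string charged to ε.

module _ (W : Cantor → ℕ → ℚ)
         (W≥0 : ∀ Y m → 0ℚ ℚ.≤ W Y m)
         (W-super : ∀ Y m → W (Y [ m ≔ false ]) (suc m) ℚ.+ W (Y [ m ≔ true ]) (suc m) ℚ.≤ W Y m)
         (G : Cantor → ℕ → ℕ)
         (G-local : ∀ {Y Z} m → Agree m Y Z → G Y m ≡ G Z m)
         (G≡0⇒ : ∀ Y m → G Y m ≡ 0 → 2^- m ℚ.≤ W Y m) where

  private
    Node : Set
    Node = ℕ × Cantor

    root : Cantor
    root _ = false

    module Search (K : ℕ) where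

      padding : ℕ → Bitstring
      padding j = K + suc j , replicate _ false

      children : Node → List Node
      children (m , Y) = (suc m , Y [ m ≔ false ]) ∷ (suc m , Y [ m ≔ true ]) ∷ []

      visit : ℕ → Node → List Node → ℕ → Bitstring × List Node
      visit j (m , Y) q zero    = (m , window Y 0 m) , q
      visit j v       q (suc _) = padding j , q ++ children v

      step : ℕ → List Node → Bitstring × List Node
      step j []            = padding j , []
      step j ((m , Y) ∷ q) = visit j (m , Y) q (G Y m)

      queue : ℕ → List Node
      queue zero    = (0 , root) ∷ []
      queue (suc j) = proj₂ (step j (queue j))

      output : ℕ → Bitstring
      output j = proj₁ (step j (queue j))

      potential : List Node → ℚ
      potential []            = 0ℚ
      potential ((m , Y) ∷ q) = W Y m ℚ.+ potential q

      potential≥0 : ∀ q → 0ℚ ℚ.≤ potential q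
      potential≥0 []            = ℚ.≤-refl
      potential≥0 ((m , Y) ∷ q) = ℚ.+-mono-≤ (W≥0 Y m) (potential≥0 q)

      potential-++ : ∀ q r → potential (q ++ r) ≡ potential q ℚ.+ potential r
      potential-++ []            r = sym (ℚ.+-identityˡ _)
      potential-++ ((m , Y) ∷ q) r =
        trans (cong (W Y m ℚ.+_) (potential-++ q r)) (sym (ℚ.+-assoc (W Y m) (potential q) (potential r)))

      potential-children : ∀ v → potential (children v) ℚ.≤ potential (v ∷ [])
      potential-children (m , Y) = begin
        W₀ ℚ.+ (W₁ ℚ.+ 0ℚ)  ≡⟨ cong (W₀ ℚ.+_) (ℚ.+-identityʳ W₁) ⟩
        W₀ ℚ.+ W₁           ≤⟨ W-super Y m ⟩
        W Y m               ≡⟨ ℚ.+-identityʳ (W Y m) ⟨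
        W Y m ℚ.+ 0ℚ        ∎
        where
        open ℚ.≤-Reasoning
        W₀ W₁ : ℚ
        W₀ = W (Y [ m ≔ false ]) (suc m)
        W₁ = W (Y [ m ≔ true ]) (suc m)

      -- The total weight of all paddings from step `j` on. It halves at every step; when a step
      -- outputs a successful string, the share of that step is forfeited.
      budget : ℕ → ℚ
      budget j = 2^- (K + j)

      padding-budget : ∀ j → 2^- ∣ padding j ∣ ℚ.+ budget (suc j) ≡ budget j
      padding-budget j = subst (λ k → 2^- k ℚ.+ 2^- k ≡ 2^- (K + j)) (sym (+-suc K j)) (2^-halves (K + j))

      budget-decreasing : ∀ j → budget (suc j) ℚ.≤ budget j
      budget-decreasing j = begin
        budget (suc j)                          ≡⟨ ℚ.+-identityˡ _ ⟨
        0ℚ ℚ.+ budget (suc j)                   ≤⟨ ℚ.+-monoˡ-≤ (budget (suc j)) (2^-≥0 ∣ padding j ∣) ⟩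
        2^- ∣ padding j ∣ ℚ.+ budget (suc j)    ≡⟨ padding-budget j ⟩
        budget j                                ∎
        where open ℚ.≤-Reasoning

      step-charge : ∀ j q → let (σ , q′) = step j q in
               2^- ∣ σ ∣ ℚ.+ (potential q′ ℚ.+ budget (suc j)) ℚ.≤ potential q ℚ.+ budget j
      step-charge j [] = begin
        w ℚ.+ (0ℚ ℚ.+ budget (suc j))  ≡⟨ cong (w ℚ.+_) (ℚ.+-identityˡ _) ⟩
        w ℚ.+ budget (suc j)           ≡⟨ padding-budget j ⟩
        budget j                       ≡⟨ ℚ.+-identityˡ _ ⟨
        0ℚ ℚ.+ budget j                ∎
        where
        open ℚ.≤-Reasoning
        w : ℚ
        w = 2^- ∣ padding j ∣
      step-charge j ((m , Y) ∷ q) with G Y m in eq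
      ... | zero = begin
        2^- m ℚ.+ (potential q ℚ.+ budget (suc j))  ≡⟨ ℚ.+-assoc (2^- m) (potential q) _ ⟨
        2^- m ℚ.+ potential q ℚ.+ budget (suc j)
          ≤⟨ ℚ.+-mono-≤ (ℚ.+-monoˡ-≤ (potential q) (G≡0⇒ Y m eq)) (budget-decreasing j) ⟩
        W Y m ℚ.+ potential q ℚ.+ budget j          ∎
        where open ℚ.≤-Reasoning
      ... | suc _ = begin
        w ℚ.+ (potential (q ++ children v) ℚ.+ budget (suc j))
          ≡⟨ solve 3 (λ a b c → a :+ (b :+ c)
               := b :+ (a :+ c)) refl w (potential (q ++ children v)) (budget (suc j)) ⟩
        potential (q ++ children v) ℚ.+ (w ℚ.+ budget (suc j))
          ≡⟨ cong₂ ℚ._+_ (potential-++ q (children v)) (padding-budget j) ⟩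
        potential q ℚ.+ potential (children v) ℚ.+ budget j
          ≤⟨ ℚ.+-monoˡ-≤ (budget j) (ℚ.+-monoʳ-≤ (potential q) (potential-children v)) ⟩
        potential q ℚ.+ (W Y m ℚ.+ 0ℚ) ℚ.+ budget j
          ≡⟨ cong (ℚ._+ budget j) (trans (cong (potential q ℚ.+_) (ℚ.+-identityʳ (W Y m))) (ℚ.+-comm (potential q) (W Y m))) ⟩
        W Y m ℚ.+ potential q ℚ.+ budget j  ∎
        where
        open ℚ.≤-Reasoning
        open ℚ-Solver.+-*-Solver
        v : Node
        v = m , Y
        w : ℚ
        w = 2^- ∣ padding j ∣

      output-≤ : ∀ k → (Σ[i< k ] λ i → 2^- ∣ output i ∣) ℚ.+ (potential (queue k) ℚ.+ budget k)
                       ℚ.≤ potential (queue 0) ℚ.+ budget 0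
      output-≤ zero    = ℚ.≤-reflexive (ℚ.+-identityˡ _)
      output-≤ (suc k) = begin
        s ℚ.+ 2^- ∣ output k ∣ ℚ.+ (potential (queue (suc k)) ℚ.+ budget (suc k))
          ≡⟨ ℚ.+-assoc s (2^- ∣ output k ∣) _ ⟩
        s ℚ.+ (2^- ∣ output k ∣ ℚ.+ (potential (queue (suc k)) ℚ.+ budget (suc k)))
          ≤⟨ ℚ.+-monoʳ-≤ s (step-charge k (queue k)) ⟩
        s ℚ.+ (potential (queue k) ℚ.+ budget k)
          ≤⟨ output-≤ k ⟩
        potential (queue 0) ℚ.+ budget 0  ∎
        where
        open ℚ.≤-Reasoning
        s : ℚ
        s = Σ[i< k ] λ i → 2^- ∣ output i ∣

      -- Children join the queue at the back, so each step shortens the list `us` of nodes ahead of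
      -- `v`. This is why the search is breadth-first: no node is postponed for ever.
      reaches-head : ∀ us {v vs} k → queue k ≡ us ++ v ∷ vs → ∃[ j ] ∃[ ws ] queue j ≡ v ∷ ws
      reaches-head []             k eq = k , _ , eq
      reaches-head ((m , Y) ∷ us) {v} {vs} k eq with G Y m in g
      ... | zero  = reaches-head us (suc k) (trans (cong (λ q → proj₂ (step k q)) eq)
                      (cong (λ x → proj₂ (visit k (m , Y) (us ++ v ∷ vs) x)) g))
      ... | suc _ = reaches-head us (suc k) (trans (cong (λ q → proj₂ (step k q)) eq)
                      (trans (cong (λ x → proj₂ (visit k (m , Y) (us ++ v ∷ vs) x)) g)
                             (++-assoc us (v ∷ vs) (children (m , Y)))))

      -- Follows `Y` down the tree: some queued node agrees with `Y` to depth `m`, and `d` is the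
      -- distance to a known success. At the head of the queue the node is either output, which
      -- already covers `Y`, or replaced by children, one of which agrees with `Y` to depth `m + 1`.
      -- At distance 0 locality of `G` excludes the second case.
      covers : ∀ {Y} d m {Z} us {vs} k → queue k ≡ us ++ (m , Z) ∷ vs → Agree m Y Z →
               G Y (m + d) ≡ 0 → ∃[ i ] N (output i) Y
      covers {Y} d m {Z} us k eq Y~Z success with reaches-head us k eq
      ... | j , ws , eq′ with G Z m in g
      ...   | zero = j , subst (λ σ → N σ Y)
                (sym (trans (cong (λ q → proj₁ (step j q)) eq′)
                            (cong (λ x → proj₁ (visit j (m , Z) ws x)) g)))
                (agree⇒∈N {m} {Y} {Z} Y~Z)
      ...   | suc x = descend d success
        where
        next : queue (suc j) ≡ ws ++ children (m , Z)
        next = trans (cong (λ q → proj₂ (step j q)) eq′)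
                     (cong (λ x → proj₂ (visit j (m , Z) ws x)) g)
        descend : ∀ d → G Y (m + d) ≡ 0 → ∃[ i ] N (output i) Y
        descend zero success = contradiction
          (trans (sym g) (trans (sym (G-local m Y~Z)) (trans (cong (G Y) (sym (+-identityʳ m))) success))) λ ()
        -- Abstracting `Y m` inside `agree-≔` selects the child on the side of `Y`; the true child
        -- has its sibling ahead of it in the queue.
        descend (suc d) success with Y m in Ym | agree-≔ {m} {Y} {Z} Y~Z
        ... | false | Y~Z′ = covers d (suc m) ws (suc j) next Y~Z′
                (trans (cong (G Y) (sym (+-suc m d))) success)
        ... | true  | Y~Z′ = covers d (suc m) (ws ++ _ ∷ []) (suc j)
                (trans next (sym (++-assoc ws (_ ∷ []) _))) Y~Z′
                (trans (cong (G Y) (sym (+-suc m d))) success)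

  Ville : μ[ (λ Y → ∃[ m ] G Y m ≡ 0) ]≤ W root 0
  Ville ε 0<ε = output ,
    (λ {Y} (m , success) → covers {Y} m 0 {root} [] 0 refl (λ i ()) success) ,
    λ k → let s = Σ[i< k ] λ i → 2^- ∣ output i ∣ in begin
      s                                                  ≡⟨ ℚ.+-identityʳ s ⟨
      s ℚ.+ 0ℚ                                           ≤⟨ ℚ.+-monoʳ-≤ s (ℚ.+-mono-≤ (potential≥0 (queue k)) (2^-≥0 (K + k))) ⟩
      s ℚ.+ (potential (queue k) ℚ.+ budget k)           ≤⟨ output-≤ k ⟩
      W root 0 ℚ.+ 0ℚ ℚ.+ budget 0                       ≡⟨ cong₂ ℚ._+_ (ℚ.+-identityʳ (W root 0)) (cong 2^-_ (+-identityʳ K)) ⟩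
      W root 0 ℚ.+ 2^- K                                 ≤⟨ ℚ.+-monoʳ-≤ (W root 0) (2^-denominator≤ 0<ε) ⟩
      W root 0 ℚ.+ ε                                     ∎
    where
    open ℚ.≤-Reasoning
    -- For the denominator `K` of `ε`, the paddings cost at most `2^- K` altogether, and
    -- `2^- K ≤ 1/K ≤ ε`.
    K : ℕ
    K = ℚ.↧ₙ ε
    open Search K

-- The betting strategy and its test

^-distribʳ-* : ∀ k m n → (m * n) ^ k ≡ m ^ k * n ^ k
^-distribʳ-* zero    m n = refl
^-distribʳ-* (suc k) m n = trans (cong (m * n *_) (^-distribʳ-* k m n))
  (solve 4 (λ m n x y → m :* n :* (x :* y) := m :* x :* (n :* y)) refl m n (m ^ k) (n ^ k))
  where open +-*-Solver

-- The martingale: whenever the preceding bits spell ρ (last bit first), the next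
-- bit is bet to be b, the capital being multiplied by (2+e)/(1+e) or e/(1+e).

_==_ : Bool → Bool → Bool
a == b = does (a Bool.≟ b)

endsWith : Cantor → ℕ → List Bool → Bool
endsWith Y m       []      = true
endsWith Y zero    (a ∷ ρ) = false
endsWith Y (suc m) (a ∷ ρ) = (Y m == a) ∧ endsWith Y m ρ

endsWith-local : ∀ {Y Z} m ρ → Agree m Y Z → endsWith Y m ρ ≡ endsWith Z m ρ
endsWith-local m       []      Y~Z = refl
endsWith-local zero    (a ∷ ρ) Y~Z = refl
endsWith-local (suc m) (a ∷ ρ) Y~Z =
  cong₂ _∧_ (cong (_== a) (Y~Z m (n<1+n m))) (endsWith-local m ρ λ i i<m → Y~Z i (m<n⇒m<1+n i<m))

bitEquals : Bool → Program 1
bitEquals true  = oracle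
bitEquals false = comp conditional (oracle ∷ zero ∷ constant 1 ∷ [])

bitEquals-⇓ : ∀ {X} a m → X ⊢ bitEquals a [ m ∷ [] ]⇓ bit (X m == a)
bitEquals-⇓ {X} true m = subst (λ b → X ⊢ oracle [ m ∷ [] ]⇓ bit b) (sym (==-true (X m))) oracle
  where
  ==-true : ∀ b → b == true ≡ b
  ==-true true  = refl
  ==-true false = refl
bitEquals-⇓ {X} false m = comp (oracle ∷ zero ∷ constant-⇓ 1 ∷ [])
  (⇓-cong (==-false (X m)) (conditional-⇓ (X m) 0 1))
  where
  ==-false : ∀ b → (if b then 0 else 1) ≡ bit (b == false)
  ==-false true  = refl
  ==-false false = refl

endsWithProgram : List Bool → Program 1
endsWithProgram []      = constant 1
endsWithProgram (a ∷ ρ) = prec zero (comp conditional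
  (comp (bitEquals a) (proj zero ∷ []) ∷ comp (endsWithProgram ρ) (proj zero ∷ []) ∷ zero ∷ []))

endsWith-⇓ : ∀ {X} ρ m → X ⊢ endsWithProgram ρ [ m ∷ [] ]⇓ bit (endsWith X m ρ)
endsWith-⇓ []      m    = constant-⇓ 1
endsWith-⇓ (a ∷ ρ) zero = prec-0 zero
endsWith-⇓ {X} (a ∷ ρ) (suc m) = prec-+ (endsWith-⇓ (a ∷ ρ) m)
  (comp (comp₁-⇓ (proj zero) (bitEquals-⇓ a m) ∷ comp₁-⇓ (proj zero) (endsWith-⇓ ρ m) ∷ zero ∷ [])
    (⇓-cong (bit-∧ (X m == a)) (conditional-⇓ (X m == a) _ 0)))
  where
  bit-∧ : ∀ x {y} → (if x then bit y else 0) ≡ bit (x ∧ y)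
  bit-∧ true  = refl
  bit-∧ false = refl

module Betting (ρ : List Bool) (b : Bool) (e : ℕ) where

  factor : Cantor → ℕ → ℕ
  factor Y m = if endsWith Y m ρ then (if Y m == b then 2 + e else e) else 1 + e

  -- The capital scaled by (1+e)^m.
  capital : Cantor → ℕ → ℕ
  capital Y zero    = 1
  capital Y (suc m) = factor Y m * capital Y m

  capital-local : ∀ {Y Z} m → Agree m Y Z → capital Y m ≡ capital Z m
  capital-local zero    Y~Z = refl
  capital-local (suc m) Y~Z = cong₂ _*_
    (cong₂ (λ x y → if x then (if y == b then 2 + e else e) else 1 + e)
      (endsWith-local m ρ Y~Z′) (Y~Z m (n<1+n m)))
    (capital-local m Y~Z′)
    where
    Y~Z′ : Agree m _ _
    Y~Z′ i i<m = Y~Z i (m<n⇒m<1+n i<m)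

  -- The bet on bit `m` and the capital before it depend only on bits below `m`, so overwriting bit
  -- `m` changes only the last factor. The two possible factors sum to `2 * (1 + e)`, whether as
  -- `(2 + e) + e` or as `(1 + e) + (1 + e)`.
  capital-fair : ∀ Y m → capital (Y [ m ≔ false ]) (suc m) + capital (Y [ m ≔ true ]) (suc m)
                         ≡ 2 * (1 + e) * capital Y m
  capital-fair Y m = trans (cong₂ _+_ (capital-≔ false) (capital-≔ true))
    (trans (sym (*-distribʳ-+ (capital Y m) (stake false) (stake true)))
           (cong (_* capital Y m) (stake-fair (endsWith Y m ρ) b)))
    where
    open +-*-Solver
    stake : Bool → ℕ
    stake a = if endsWith Y m ρ then (if a == b then 2 + e else e) else 1 + e
    capital-≔ : ∀ a → capital (Y [ m ≔ a ]) (suc m) ≡ stake a * capital Y m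
    capital-≔ a = cong₂ _*_
      (cong₂ (λ x y → if x then (if y == b then 2 + e else e) else 1 + e)
        (endsWith-local m ρ (≔-below Y m a)) (≔-at Y m a))
      (capital-local m (≔-below Y m a))
    stake-fair : ∀ x b → (if x then (if false == b then 2 + e else e) else 1 + e)
                         + (if x then (if true == b then 2 + e else e) else 1 + e) ≡ 2 * (1 + e)
    stake-fair false b     = solve 1 (λ e → con 1 :+ e :+ (con 1 :+ e) := con 2 :* (con 1 :+ e)) refl e
    stake-fair true  false = solve 1 (λ e → con 2 :+ e :+ e := con 2 :* (con 1 :+ e)) refl e
    stake-fair true  true  = solve 1 (λ e → e :+ (con 2 :+ e) := con 2 :* (con 1 :+ e)) refl e

  capitalProgram : Program 1
  capitalProgram = prec (constant 1) (comp mul (comp factorProgram (proj zero ∷ []) ∷ proj (suc zero) ∷ []))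
    where
    factorProgram : Program 1
    factorProgram = comp conditional (endsWithProgram ρ ∷
      comp conditional (bitEquals b ∷ constant (2 + e) ∷ constant e ∷ []) ∷ constant (1 + e) ∷ [])

  capital-⇓ : ∀ {X} m → X ⊢ capitalProgram [ m ∷ [] ]⇓ capital X m
  capital-⇓ zero        = prec-0 (constant-⇓ 1)
  capital-⇓ {X} (suc m) = prec-+ (capital-⇓ m) (comp₂-⇓ (comp₁-⇓ (proj zero)
    (comp (endsWith-⇓ ρ m ∷ comp (bitEquals-⇓ b m ∷ constant-⇓ (2 + e) ∷ constant-⇓ e ∷ [])
             (conditional-⇓ (X m == b) (2 + e) e) ∷ constant-⇓ (1 + e) ∷ [])
      (conditional-⇓ (endsWith X m ρ) _ (1 + e))))
    (proj (suc zero)) (mul-⇓ (factor X m) (capital X m)))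

  -- Zero exactly when the capital after m bits is at least 2^n.
  deficit : Cantor → ℕ → ℕ → ℕ
  deficit Y m n = 2 ^ n * (1 + e) ^ m ∸ capital Y m

  deficitProgram : Program 2
  deficitProgram = comp monus
    (comp mul (comp power (constant 2 ∷ proj (suc zero) ∷ []) ∷
               comp power (constant (1 + e) ∷ proj zero ∷ []) ∷ []) ∷
     comp capitalProgram (proj zero ∷ []) ∷ [])

  deficit-⇓ : ∀ X m n → X ⊢ deficitProgram [ m ∷ n ∷ [] ]⇓ deficit X m n
  deficit-⇓ X m n = comp₂-⇓
    (comp₂-⇓ (comp₂-⇓ (constant-⇓ 2) (proj (suc zero)) (power-⇓ 2 n))
             (comp₂-⇓ (constant-⇓ (1 + e)) (proj zero) (power-⇓ (1 + e) m))
             (mul-⇓ (2 ^ n) ((1 + e) ^ m)))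
    (comp₁-⇓ (proj zero) (capital-⇓ m))
    (monus-⇓ (2 ^ n * (1 + e) ^ m) (capital X m))

  module _ (n : ℕ) where

    -- Three normalisations: `(1 + e) ^ m` undoes the scaling of the capital, `2 ^ m` turns the
    -- martingale into the `W` of Ville's inequality, and `2 ^ n` makes the initial weight `2^- n`,
    -- so that reaching capital `2 ^ n` means weight at least `2^- m`.
    scale : ℕ → ℕ
    scale m = 2 ^ n * (2 * (1 + e)) ^ m

    scale≢0 : ∀ m → NonZero (scale m)
    scale≢0 m = m*n≢0 (2 ^ n) _ {{m^n≢0 2 n}} {{m^n≢0 (2 * (1 + e)) m}}

    weight : Cantor → ℕ → ℚ
    weight Y m = _/_ (ℤ.+ capital Y m) (scale m) {{scale≢0 m}}

    weight-fair : ∀ Y m → weight (Y [ m ≔ false ]) (suc m) ℚ.+ weight (Y [ m ≔ true ]) (suc m) ℚ.≤ weight Y m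
    weight-fair Y m = subst (ℚ._≤ weight Y m) (sym (/-+ c₀ q c₁ q))
      (/-mono-≤ (c₀ * q + c₁ * q) (q * q) (capital Y m) p (≤-reflexive (begin
        (c₀ * q + c₁ * q) * p                  ≡⟨ cong (_* p) (*-distribʳ-+ q c₀ c₁) ⟨
        (c₀ + c₁) * q * p                      ≡⟨ cong (λ x → x * q * p) (capital-fair Y m) ⟩
        2 * (1 + e) * capital Y m * q * p
          ≡⟨ solve 5 (λ k c q r s → k :* c :* q :* (r :* s) := c :* (q :* (r :* (k :* s))))
                                                    refl (2 * (1 + e)) (capital Y m) q (2 ^ n) ((2 * (1 + e)) ^ m) ⟩
        capital Y m * (q * q)                  ∎)))
      where
      open ≡-Reasoning
      open +-*-Solver
      c₀ c₁ p q : ℕ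
      c₀ = capital (Y [ m ≔ false ]) (suc m)
      c₁ = capital (Y [ m ≔ true ]) (suc m)
      p  = scale m
      q  = scale (suc m)
      instance
        p≢0 : NonZero p
        p≢0 = scale≢0 m
        q≢0 : NonZero q
        q≢0 = scale≢0 (suc m)
        q*q≢0 : NonZero (q * q)
        q*q≢0 = m*n≢0 q q

    deficit≡0⇒ : ∀ Y m → deficit Y m n ≡ 0 → 2^- m ℚ.≤ weight Y m
    deficit≡0⇒ Y m success = /-mono-≤ 1 (2 ^ m) (capital Y m) (scale m) {{m^n≢0 2 m}} {{scale≢0 m}} (begin
      1 * scale m                      ≡⟨ cong (λ x → 1 * (2 ^ n * x)) (^-distribʳ-* m 2 (1 + e)) ⟩
      1 * (2 ^ n * (2 ^ m * c^m))
        ≡⟨ solve 3 (λ x y z → con 1 :* (x :* (y :* z)) := x :* z :* y) refl (2 ^ n) (2 ^ m) c^m ⟩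
      2 ^ n * c^m * 2 ^ m              ≤⟨ *-monoˡ-≤ (2 ^ m) (m∸n≡0⇒m≤n {2 ^ n * c^m} {capital Y m} success) ⟩
      capital Y m * 2 ^ m              ∎)
      where
      open ≤-Reasoning
      open +-*-Solver
      c^m : ℕ
      c^m = (1 + e) ^ m

    success-small : μ[ (λ Y → ∃[ m ] deficit Y m n ≡ 0) ]≤ (2^- n)
    success-small = subst (μ[ (λ Y → ∃[ m ] deficit Y m n ≡ 0) ]≤_) (/-cong-≡ 1 (scale 0) 1 (2 ^ n) {{scale≢0 0}} {{m^n≢0 2 n}}
        (cong (1 *_) (sym (*-identityʳ (2 ^ n)))))
      (Ville weight (λ Y m → /-nonNegative (capital Y m) (scale m) {{scale≢0 m}}) weight-fair
        (λ Y m → deficit Y m n)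
        (λ m Y~Z → cong (2 ^ n * (1 + e) ^ m ∸_) (capital-local m Y~Z))
        deficit≡0⇒)

  -- Otherwise `X` passes every level and lies in the whole test. Randomness is a negative
  -- statement; excluded middle extracts from it a level that is never reached.
  random⇒capital-bounded : ExcludedMiddle 0ℓ → ∀ X → Random X →
                           ∃[ n ] ∀ m → capital X m < 2 ^ n * (1 + e) ^ m
  random⇒capital-bounded em X random with em {∃[ n ] ¬ (∃[ m ] deficit X m n ≡ 0)}
  ... | yes (n , never) = n , λ m → ≰⇒> λ 2^n≤ → never (m , m≤n⇒m∸n≡0 2^n≤)
  -- The effectively null set is the intersection of the test itself.
  ... | no succeeds = ⊥-elim (random _
          (_ , uniformlyΣ⁰₁-search deficitProgram deficit deficit-⇓ , success-small , λ X∈V → X∈V)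
          X∈V)
    where
    X∈V : ∀ n → ∃[ m ] deficit X m n ≡ 0
    X∈V n with em {∃[ m ] deficit X m n ≡ 0}
    ... | yes success = success
    ... | no  never   = contradiction (n , never) succeeds

-- Exponential growth of the capital

-- Bernoulli's inequality 1 + t/c ≤ (1 + 1/c)^t, multiplied by c^(t+1). For `c = suc e` the base 1 +
-- 1/c is the factor of a won bet.
^-bernoulli : ∀ c t → c ^ t * (c + t) ≤ c * suc c ^ t
^-bernoulli c zero    = ≤-reflexive (solve 1 (λ c → con 1 :* (c :+ con 0) := c :* con 1) refl c)
  where open +-*-Solver
^-bernoulli c (suc t) = begin
  c * x * (c + suc t)           ≤⟨ m≤m+n _ (x * t) ⟩
  c * x * (c + suc t) + x * t   ≡⟨ solve 3 (λ c x t → c :* x :* (c :+ (con 1 :+ t)) :+ x :* t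
                                     := (con 1 :+ c) :* (x :* (c :+ t))) refl c x t ⟩
  suc c * (x * (c + t))         ≤⟨ *-monoʳ-≤ (suc c) (^-bernoulli c t) ⟩
  suc c * (c * suc c ^ t)
    ≡⟨ solve 2 (λ c z → (con 1 :+ c) :* (c :* z) := c :* ((con 1 :+ c) :* z)) refl c (suc c ^ t) ⟩
  c * (suc c * suc c ^ t)       ∎
  where
  open ≤-Reasoning
  open +-*-Solver
  x : ℕ
  x = c ^ t

-- Bernoulli's inequality 1 - j/(y+1) ≤ (1 - 1/(y+1))^j, cleared of denominators and signs.
^-bernoulli⁻ : ∀ y j → suc y ^ j * suc y ≤ y ^ j * suc y + j * suc y ^ j
^-bernoulli⁻ y zero    = m≤m+n _ 0
^-bernoulli⁻ y (suc j) = begin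
  suc y * z * suc y
    ≡⟨ solve 2 (λ y z → (con 1 :+ y) :* z :* (con 1 :+ y) := y :* (z :* (con 1 :+ y)) :+ (con 1 :+ y) :* z) refl y z ⟩
  y * (z * suc y) + suc y * z                        ≤⟨ +-monoˡ-≤ (suc y * z) (*-monoʳ-≤ y (^-bernoulli⁻ y j)) ⟩
  y * (y ^ j * suc y + j * z) + suc y * z            ≤⟨ m≤m+n _ (j * z) ⟩
  y * (y ^ j * suc y + j * z) + suc y * z + j * z
    ≡⟨ solve 4 (λ y w j z → y :* (w :* (con 1 :+ y) :+ j :* z) :+ (con 1 :+ y) :* z :+ j :* z
                                                         
                                                               := y :* w :* (con 1 :+ y) :+ (con 1 :+ j) :* ((con 1 :+ y) :* z)) refl y (y ^ j) j z ⟩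
  y * y ^ j * suc y + suc j * (suc y * z)            ∎
  where
  open ≤-Reasoning
  open +-*-Solver
  z : ℕ
  z = suc y ^ j

-- One extra win outweighs the loss of capital over e pairs of a win and a loss.
balanced-growth : ∀ e → suc e * (suc e * suc e) ^ e ≤ (2 + e) * (e * (2 + e)) ^ e
balanced-growth e = subst (λ x → suc e * x ^ e ≤ (2 + e) * y ^ e) (sym square)
  (*-cancelʳ-≤ (suc e * z) ((2 + e) * y ^ e) (suc y) (+-cancelʳ-≤ ((2 + e) * (e * z)) _ _ (begin
    -- Since `suc y` is (1+e)², the slack `z` comes from (2+e)((1+e)² - e) = (1+e)³ + 1; the
    -- subtracted term stands on both sides instead.
    suc e * z * suc y + (2 + e) * (e * z)          ≤⟨ m≤m+n _ z ⟩
    suc e * z * suc y + (2 + e) * (e * z) + z      ≡⟨ solve 2 (λ e z →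
      (con 1 :+ e) :* z :* (con 1 :+ e :* (con 2 :+ e)) :+ (con 2 :+ e) :* (e :* z) :+ z
      := (con 2 :+ e) :* (z :* (con 1 :+ e :* (con 2 :+ e)))) refl e z ⟩
    (2 + e) * (z * suc y)                          ≤⟨ *-monoʳ-≤ (2 + e) (^-bernoulli⁻ y e) ⟩
    (2 + e) * (y ^ e * suc y + e * z)
      ≡⟨ solve 4 (λ c w y′ v → c :* (w :* y′ :+ v) := c :* w :* y′ :+ c :* v)
                                                        refl (2 + e) (y ^ e) (suc y) (e * z) ⟩
    (2 + e) * y ^ e * suc y + (2 + e) * (e * z)    ∎)))
  where
  open ≤-Reasoning
  open +-*-Solver
  y z : ℕ
  y = e * (2 + e)
  z = suc y ^ e
  square : suc e * suc e ≡ suc y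
  square = solve 1 (λ e → (con 1 :+ e) :* (con 1 :+ e) := con 1 :+ e :* (con 2 :+ e)) refl e

-- Raise the bound to the power `e` and write `e * p` as `e * q + q + t`. The `e * p` wins and
-- `e * q` losses then form `q` blocks of `e + 1` wins and `e` losses, none of which lowers the
-- capital by `balanced-growth`, and `t` further wins; `gains` and `budget` regroup the two sides
-- accordingly. What remains is ((2+e)/(1+e))^t ≤ (2^n)^e, and Bernoulli's inequality bounds `t` by
-- the constant of the conclusion.
bounded-capital⇒balance : ∀ e n p q → (2 + e) ^ p * e ^ q ≤ 2 ^ n * suc e ^ (p + q) →
                          e * p ≤ e * q + (q + suc e * (2 ^ n) ^ e)
bounded-capital⇒balance e n p q bound with e * p ≤? e * q + q
... | yes small = ≤-trans small (+-monoʳ-≤ (e * q) (m≤m+n q _))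
... | no  large = begin
  e * p                        ≡⟨ excess ⟨
  e * q + q + t                ≤⟨ +-monoʳ-≤ (e * q + q) t≤ ⟩
  e * q + q + suc e * Z        ≡⟨ +-assoc (e * q) q _ ⟩
  e * q + (q + suc e * Z)      ∎
  where
  open ≤-Reasoning
  open +-*-Solver
  c d Z t A B : ℕ
  c = suc e
  d = 2 + e
  Z = (2 ^ n) ^ e
  t = e * p ∸ (e * q + q)
  A = d * (e * d) ^ e
  B = c * (c * c) ^ e

  excess : e * q + q + t ≡ e * p
  excess = m+[n∸m]≡n (<⇒≤ (≰⇒> large))

  power-product : ∀ x → x ^ (e * q + q + t) ≡ (x ^ e * x) ^ q * x ^ t
  power-product x = begin-equality
    x ^ (e * q + q + t)            ≡⟨ ^-distribˡ-+-* x (e * q + q) t ⟩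
    x ^ (e * q + q) * x ^ t        ≡⟨ cong (_* x ^ t) (^-distribˡ-+-* x (e * q) q) ⟩
    x ^ (e * q) * x ^ q * x ^ t    ≡⟨ cong (λ y → y * x ^ q * x ^ t) (^-*-assoc x e q) ⟨
    (x ^ e) ^ q * x ^ q * x ^ t    ≡⟨ cong (_* x ^ t) (^-distribʳ-* q (x ^ e) x) ⟨
    (x ^ e * x) ^ q * x ^ t        ∎

  swap-exponents : ∀ x y z → (x ^ y) ^ z ≡ (x ^ z) ^ y
  swap-exponents x y z = trans (^-*-assoc x y z) (trans (cong (x ^_) (*-comm y z)) (sym (^-*-assoc x z y)))

  gains : ((2 + e) ^ p * e ^ q) ^ e ≡ A ^ q * d ^ t
  gains = begin-equality
    (d ^ p * e ^ q) ^ e                      ≡⟨ ^-distribʳ-* e (d ^ p) (e ^ q) ⟩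
    (d ^ p) ^ e * (e ^ q) ^ e                ≡⟨ cong₂ _*_ (trans (^-*-assoc d p e) (cong (d ^_) (trans (*-comm p e) (sym excess))))
                                                                     (swap-exponents e q e) ⟩
    d ^ (e * q + q + t) * (e ^ e) ^ q        ≡⟨ cong (_* (e ^ e) ^ q) (power-product d) ⟩
    (d ^ e * d) ^ q * d ^ t * (e ^ e) ^ q
      ≡⟨ solve 3 (λ x y z → x :* y :* z := x :* z :* y) refl ((d ^ e * d) ^ q) (d ^ t) ((e ^ e) ^ q) ⟩
    (d ^ e * d) ^ q * (e ^ e) ^ q * d ^ t    ≡⟨ cong (_* d ^ t) (^-distribʳ-* q (d ^ e * d) (e ^ e)) ⟨
    (d ^ e * d * e ^ e) ^ q * d ^ t          ≡⟨ cong (λ x → x ^ q * d ^ t) (trans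
                                                (solve 3 (λ x y z → x :* y :* z
                                                     := y :* (z :* x)) refl (d ^ e) d (e ^ e))
                                                (cong (d *_) (sym (^-distribʳ-* e e d)))) ⟩
    A ^ q * d ^ t                            ∎

  budget : (2 ^ n * c ^ (p + q)) ^ e ≡ B ^ q * (c ^ t * Z)
  budget = begin-equality
    (2 ^ n * c ^ (p + q)) ^ e                ≡⟨ ^-distribʳ-* e (2 ^ n) _ ⟩
    Z * (c ^ (p + q)) ^ e                    ≡⟨ cong (Z *_) (^-*-assoc c (p + q) e) ⟩
    Z * c ^ ((p + q) * e)                    ≡⟨ cong (λ x → Z * c ^ x) (trans
                                                (solve 3 (λ p q e → (p :+ q) :* e := e :* p :+ e :* q) refl p q e)
                                                (cong (_+ e * q) (sym excess))) ⟩
    Z * c ^ (e * q + q + t + e * q)          ≡⟨ cong (Z *_) (^-distribˡ-+-* c (e * q + q + t) (e * q)) ⟩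
    Z * (c ^ (e * q + q + t) * c ^ (e * q))  ≡⟨ cong (Z *_) (cong₂ _*_ (power-product c) (sym (^-*-assoc c e q))) ⟩
    Z * ((c ^ e * c) ^ q * c ^ t * (c ^ e) ^ q)
      ≡⟨ solve 4 (λ z x y w → z :* (x :* y :* w)
           := x :* w :* (y :* z)) refl Z ((c ^ e * c) ^ q) (c ^ t) ((c ^ e) ^ q) ⟩
    (c ^ e * c) ^ q * (c ^ e) ^ q * (c ^ t * Z)
      ≡⟨ cong (_* (c ^ t * Z)) (^-distribʳ-* q (c ^ e * c) (c ^ e)) ⟨
    (c ^ e * c * c ^ e) ^ q * (c ^ t * Z)    ≡⟨ cong (λ x → x ^ q * (c ^ t * Z)) (trans
                                                (solve 2 (λ x y → x :* y :* x := y :* (x :* x)) refl (c ^ e) c)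
                                                (cong (c *_) (sym (^-distribʳ-* e c c)))) ⟩
    B ^ q * (c ^ t * Z)                      ∎

  B^q≢0 : NonZero (B ^ q)
  B^q≢0 = m^n≢0 B q {{m*n≢0 c _ {{_}} {{m^n≢0 (c * c) e}}}}

  surplus : d ^ t ≤ c ^ t * Z
  surplus = *-cancelˡ-≤ (B ^ q) {{B^q≢0}} (begin
    B ^ q * d ^ t                  ≤⟨ *-monoˡ-≤ (d ^ t) (^-monoˡ-≤ q (balanced-growth e)) ⟩
    A ^ q * d ^ t                  ≡⟨ gains ⟨
    (d ^ p * e ^ q) ^ e            ≤⟨ ^-monoˡ-≤ e bound ⟩
    (2 ^ n * c ^ (p + q)) ^ e      ≡⟨ budget ⟩
    B ^ q * (c ^ t * Z)            ∎)

  t≤ : t ≤ c * Z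
  t≤ = ≤-trans (m≤n+m t c) (*-cancelˡ-≤ (c ^ t) {{m^n≢0 c t}} (begin
    c ^ t * (c + t)       ≤⟨ ^-bernoulli c t ⟩
    c * d ^ t             ≤⟨ *-monoʳ-≤ c surplus ⟩
    c * (c ^ t * Z)       ≡⟨ solve 3 (λ c x z → c :* (x :* z) := x :* (c :* z)) refl c (c ^ t) Z ⟩
    c ^ t * (c * Z)       ∎))

-- Counting

count : (ℕ → Bool) → ℕ → ℕ
count f zero    = 0
count f (suc m) = bit (f m) + count f m

count-cong : ∀ {f g} → (∀ m → f m ≡ g m) → ∀ m → count f m ≡ count g m
count-cong f≗g zero    = refl
count-cong f≗g (suc m) = cong₂ _+_ (cong bit (f≗g m)) (count-cong f≗g m)

count-≤ : ∀ f m → count f m ≤ m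
count-≤ f zero    = z≤n
count-≤ f (suc m) = +-mono-≤ (bit≤1 (f m)) (count-≤ f m)
  where
  bit≤1 : ∀ b → bit b ≤ 1
  bit≤1 true  = ≤-refl
  bit≤1 false = z≤n

count-+ : ∀ f m n → count f (m + n) ≡ count (λ i → f (i + n)) m + count f n
count-+ f zero    n = refl
count-+ f (suc m) n = trans (cong (bit (f (m + n)) +_) (count-+ f m n)) (sym (+-assoc (bit (f (m + n))) _ _))

length-filter-upTo : ∀ {P : Pred ℕ 0ℓ} (P? : Decidable P) n →
                     length (filter P? (upTo n)) ≡ count (λ i → does (P? i)) n
length-filter-upTo P? zero    = refl
length-filter-upTo P? (suc n) = begin
  length (filter P? (upTo (suc n)))                        ≡⟨ cong (λ is → length (filter P? is)) (upTo-∷ʳ n) ⟨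
  length (filter P? (upTo n ++ n ∷ []))                    ≡⟨ cong length (filter-++ P? (upTo n) (n ∷ [])) ⟩
  length (filter P? (upTo n) ++ filter P? (n ∷ []))        ≡⟨ length-++ (filter P? (upTo n)) ⟩
  length (filter P? (upTo n)) + length (filter P? (n ∷ [])) ≡⟨ cong₂ _+_ (length-filter-upTo P? n) last ⟩
  count (λ i → does (P? i)) n + bit (does (P? n))          ≡⟨ +-comm (count (λ i → does (P? i)) n) _ ⟩
  count (λ i → does (P? i)) (suc n)                        ∎
  where
  open ≡-Reasoning
  last : length (filter P? (n ∷ [])) ≡ bit (does (P? n))
  last with does (P? n)
  ... | true  = refl
  ... | false = refl

endings : Cantor → List Bool → ℕ → ℕ
endings X ρ = count (λ m → endsWith X m ρ)

continuations : Cantor → List Bool → Bool → ℕ → ℕ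
continuations X ρ a = count (λ m → (X m == a) ∧ endsWith X m ρ)

-- `a ∷ ρ` ends at `m + 1` when `ρ` ends at `m` and bit `m` is `a`; at position 0 no nonempty word
-- ends. Hence the shift by one.
endings-∷ : ∀ X a ρ M → endings X (a ∷ ρ) (suc M) ≡ continuations X ρ a M
endings-∷ X a ρ zero    = refl
endings-∷ X a ρ (suc M) = cong (bit ((X M == a) ∧ endsWith X M ρ) +_) (endings-∷ X a ρ M)

==-not : ∀ a b → a == not b ≡ not (a == b)
==-not true  true  = refl
==-not true  false = refl
==-not false true  = refl
==-not false false = refl

endings-split : ∀ X ρ a M → continuations X ρ a M + continuations X ρ (not a) M ≡ endings X ρ M
endings-split X ρ a zero    = refl
endings-split X ρ a (suc M) = begin
  bit (x ∧ y) + p + (bit ((X M == not a) ∧ y) + q)   ≡⟨ cong (λ z → bit (x ∧ y) + p + (bit (z ∧ y) + q)) (==-not (X M) a) ⟩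
  bit (x ∧ y) + p + (bit (not x ∧ y) + q)
    ≡⟨ solve 4 (λ a b c d → a :+ b :+ (c :+ d) := (a :+ c) :+ (b :+ d)) refl (bit (x ∧ y)) p (bit (not x ∧ y)) q ⟩
  (bit (x ∧ y) + bit (not x ∧ y)) + (p + q)          ≡⟨ cong₂ _+_ (split x y) (endings-split X ρ a M) ⟩
  bit y + endings X ρ M                              ∎
  where
  open ≡-Reasoning
  open +-*-Solver
  x y : Bool
  x = X M == a
  y = endsWith X M ρ
  p q : ℕ
  p = continuations X ρ a M
  q = continuations X ρ (not a) M
  split : ∀ x y → bit (x ∧ y) + bit (not x ∧ y) ≡ bit y
  split true  y = +-identityʳ (bit y)
  split false y = refl

-- Balance between the two continuations of a word

module _ (X : Cantor) (ρ : List Bool) (b : Bool) (e : ℕ) where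
  open Betting ρ b e

  private
    p q : ℕ → ℕ
    p = continuations X ρ b
    q = continuations X ρ (not b)

  -- The scaled capital has one factor `2 + e` per win, `e` per loss and `suc e` for each of the M -
  -- (p M + q M) rounds without a bet. The power on the left avoids the subtraction.
  capital-count : ∀ M → capital X M * suc e ^ (p M + q M) ≡ (2 + e) ^ p M * e ^ q M * suc e ^ M
  capital-count zero    = refl
  capital-count (suc M) = trans
    (cong (λ z → factor X M * capital X M * suc e ^ ((bit (x ∧ y) + p M) + (bit (z ∧ y) + q M))) (==-not (X M) b))
    (trans (step x y (p M) (q M) (capital-count M))
      (cong (λ z → (2 + e) ^ (bit (x ∧ y) + p M) * e ^ (bit (z ∧ y) + q M) * suc e ^ suc M) (sym (==-not (X M) b))))
    where
    open +-*-Solver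
    x y : Bool
    x = X M == b
    y = endsWith X M ρ
    k : ℕ
    k = capital X M
    step : ∀ x y p q → k * suc e ^ (p + q) ≡ (2 + e) ^ p * e ^ q * suc e ^ M →
           (if y then (if x then 2 + e else e) else suc e) * k * suc e ^ ((bit (x ∧ y) + p) + (bit (not x ∧ y) + q))
           ≡ (2 + e) ^ (bit (x ∧ y) + p) * e ^ (bit (not x ∧ y) + q) * suc e ^ suc M
    step true true p q eq = trans
      (solve 4 (λ a k c s → a :* k :* (c :* s) := a :* c :* (k :* s)) refl (2 + e) k (suc e) (suc e ^ (p + q)))
      (trans (cong ((2 + e) * suc e *_) eq)
        (solve 5 (λ a c x y z → a :* c :* (x :* y :* z)
             := a :* x :* y :* (c :* z)) refl (2 + e) (suc e) ((2 + e) ^ p) (e ^ q) (suc e ^ M)))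
    step false true p q eq = trans (cong (λ i → e * k * suc e ^ i) (+-suc p q)) (trans
      (solve 4 (λ a k c s → a :* k :* (c :* s) := a :* c :* (k :* s)) refl e k (suc e) (suc e ^ (p + q)))
      (trans (cong (e * suc e *_) eq)
        (solve 5 (λ a c x y z → a :* c :* (x :* y :* z)
             := x :* (a :* y) :* (c :* z)) refl e (suc e) ((2 + e) ^ p) (e ^ q) (suc e ^ M))))
    step x false p q eq rewrite Bool.∧-zeroʳ x | Bool.∧-zeroʳ (not x) = trans
      (*-assoc (suc e) k _) (trans (cong (suc e *_) eq)
        (solve 4 (λ c x y z → c :* (x :* y :* z)
             := x :* y :* (c :* z)) refl (suc e) ((2 + e) ^ p) (e ^ q) (suc e ^ M)))

  random⇒balance : ExcludedMiddle 0ℓ → Random X → ∃[ K ] ∀ M → e * p M ≤ e * q M + (q M + K)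
  random⇒balance em random with random⇒capital-bounded em X random
  ... | n , bound = suc e * (2 ^ n) ^ e , λ M → bounded-capital⇒balance e n (p M) (q M)
    (*-cancelʳ-≤ _ _ (suc e ^ M) {{m^n≢0 (suc e) M}} (begin
      (2 + e) ^ p M * e ^ q M * suc e ^ M        ≡⟨ capital-count M ⟨
      capital X M * suc e ^ (p M + q M)          ≤⟨ *-monoˡ-≤ (suc e ^ (p M + q M)) (<⇒≤ (bound M)) ⟩
      2 ^ n * suc e ^ M * suc e ^ (p M + q M)
        ≡⟨ solve 3 (λ x y z → x :* y :* z := x :* z :* y) refl (2 ^ n) (suc e ^ M) (suc e ^ (p M + q M)) ⟩
      2 ^ n * suc e ^ (p M + q M) * suc e ^ M    ∎))
    where
    open ≤-Reasoning
    open +-*-Solver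

-- c M / M tends to 1/L.  An additive constant K, in place of a threshold for M,
-- absorbs shifts of the index.
ReciprocalDensity : ℕ → (ℕ → ℕ) → Set
ReciprocalDensity L c = ∀ e → ∃[ K ] ∀ M →
  (e * (L * c M) ≤ e * M + (M + K)) × (e * M ≤ e * (L * c M) + (M + K))

-- Density of words by induction on length

module _ (em : ExcludedMiddle 0ℓ) (X : Cantor) (random : Random X) where

  -- With `p` and `q` the two continuation counts of `ρ`, split 2Lp as L(p+q) + L(p-q). The density
  -- of `ρ` controls the first summand up to about M/E, and the balance controls the second up to
  -- about LM/E. Taking `E = (1 + L) * e` makes the total error M/e.
  endings-density : ∀ ρ → ReciprocalDensity (2 ^ length ρ) (endings X ρ)
  endings-density [] e = 0 , λ M → subst (λ c → (e * (1 * c) ≤ e * M + (M + 0)) × (e * M ≤ e * (1 * c) + (M + 0)))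
      (sym (count-true M)) (bound M (*-identityˡ M) , bound′ M (*-identityˡ M))
    where
    count-true : ∀ M → count (λ _ → true) M ≡ M
    count-true zero    = refl
    count-true (suc M) = cong suc (count-true M)
    bound : ∀ M {c} → c ≡ M → e * c ≤ e * M + (M + 0)
    bound M refl = m≤m+n _ _
    bound′ : ∀ M {c} → c ≡ M → e * M ≤ e * c + (M + 0)
    bound′ M refl = m≤m+n _ _
  endings-density (b ∷ ρ) e with endings-density ρ ((1 + 2 ^ length ρ) * e)
    | random⇒balance X ρ b ((1 + 2 ^ length ρ) * e) em random
    | random⇒balance X ρ (not b) ((1 + 2 ^ length ρ) * e) em random
  ... | K₀ , density | K₁ , balance₁ | K₂ , balance₂ = K , bounds
    where
    open ≤-Reasoning
    open +-*-Solver
    L E K : ℕ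
    L = 2 ^ length ρ
    E = (1 + L) * e
    -- `upper` uses `K₀ + L * K₁` and `lower` uses `K₀ + L * K₂`, both larger than what division by
    -- `1 + L` would leave. The last `e` pays in `lower` for passing from `e * M` to `e * suc M`.
    K = K₀ + L * K₁ + L * K₂ + e

    module _ (M p q : ℕ) (p+q≤M : p + q ≤ M)
             (density-≤ : E * (L * (p + q)) ≤ E * M + (M + K₀))
             (density-≥ : E * M ≤ E * (L * (p + q)) + (M + K₀))
             (p≤ : E * p ≤ E * q + (q + K₁))
             (q≤ : E * q ≤ E * p + (p + K₂)) where

      upper : e * (2 * L * p) ≤ e * suc M + (suc M + K)
      upper = ≤-trans (*-cancelˡ-≤ (1 + L) (begin
        (1 + L) * (e * (2 * L * p))
          ≡⟨ solve 3 (λ L e p → (con 1 :+ L) :* (e :* (con 2 :* L :* p))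
               := L :* ((con 1 :+ L) :* e :* p :+ (con 1 :+ L) :* e :* p)) refl L e p ⟩
        L * (E * p + E * p)                      ≤⟨ *-monoʳ-≤ L (+-monoʳ-≤ (E * p) p≤) ⟩
        L * (E * p + (E * q + (q + K₁)))         ≤⟨ *-monoʳ-≤ L (+-monoʳ-≤ (E * p) (+-monoʳ-≤ (E * q) (+-monoˡ-≤ K₁ (m+n≤o⇒n≤o p p+q≤M)))) ⟩
        L * (E * p + (E * q + (M + K₁)))
          ≡⟨ solve 6 (λ L E p q M K → L :* (E :* p :+ (E :* q :+ (M :+ K)))
               := E :* (L :* (p :+ q)) :+ L :* (M :+ K)) refl L E p q M K₁ ⟩
        E * (L * (p + q)) + L * (M + K₁)         ≤⟨ +-monoˡ-≤ (L * (M + K₁)) density-≤ ⟩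
        E * M + (M + K₀) + L * (M + K₁)
          ≤⟨ m≤m+n _ (L * K₀ + L * (L * K₁)) ⟩
        E * M + (M + K₀) + L * (M + K₁) + (L * K₀ + L * (L * K₁))
          ≡⟨ solve 5 (λ L e M K₀ K₁ → (con 1 :+ L) :* e :* M :+ (M :+ K₀) :+ L :* (M :+ K₁) :+ (L :* K₀ :+ L :* (L :* K₁))
                := (con 1 :+ L) :* (e :* M :+ (M :+ (K₀ :+ L :* K₁)))) refl L e M K₀ K₁ ⟩
        (1 + L) * (e * M + (M + (K₀ + L * K₁))) ∎))
        (+-mono-≤ (*-monoʳ-≤ e (n≤1+n M)) (+-mono-≤ (n≤1+n M) (≤-trans (m≤m+n _ (L * K₂)) (m≤m+n _ e))))

      lower : e * suc M ≤ e * (2 * L * p) + (suc M + K)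
      lower = begin
        e * suc M      ≡⟨ *-suc e M ⟩
        e + e * M      ≤⟨ +-monoʳ-≤ e (*-cancelˡ-≤ (1 + L) (begin
          (1 + L) * (e * M)                        ≡⟨ *-assoc (1 + L) e M ⟨
          E * M                                    ≤⟨ density-≥ ⟩
          E * (L * (p + q)) + (M + K₀)
            ≡⟨ solve 6 (λ L E p q M K → E :* (L :* (p :+ q)) :+ (M :+ K)
                 := L :* (E :* p :+ E :* q) :+ (M :+ K)) refl L E p q M K₀ ⟩
          L * (E * p + E * q) + (M + K₀)           ≤⟨ +-monoˡ-≤ (M + K₀) (*-monoʳ-≤ L (+-monoʳ-≤ (E * p) q≤)) ⟩
          L * (E * p + (E * p + (p + K₂))) + (M + K₀)
            ≤⟨ +-monoˡ-≤ (M + K₀) (*-monoʳ-≤ L (+-monoʳ-≤ (E * p) (+-monoʳ-≤ (E * p) (+-monoˡ-≤ K₂ (m+n≤o⇒m≤o p p+q≤M))))) ⟩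
          L * (E * p + (E * p + (M + K₂))) + (M + K₀)
            ≤⟨ m≤m+n _ (L * K₀ + L * (L * K₂)) ⟩
          L * (E * p + (E * p + (M + K₂))) + (M + K₀) + (L * K₀ + L * (L * K₂))
            ≡⟨ solve 6 (λ L e p M K₀ K₂ →
                 L :* ((con 1 :+ L) :* e :* p :+ ((con 1 :+ L) :* e :* p :+ (M :+ K₂))) :+ (M :+ K₀) :+ (L :* K₀ :+ L :* (L :* K₂))
                 := (con 1 :+ L) :* (e :* (con 2 :* L :* p) :+ (M :+ (K₀ :+ L :* K₂)))) refl L e p M K₀ K₂ ⟩
          (1 + L) * (e * (2 * L * p) + (M + (K₀ + L * K₂))) ∎)) ⟩
        e + (e * (2 * L * p) + (M + (K₀ + L * K₂)))
          ≤⟨ m≤m+n _ (1 + L * K₁) ⟩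
        e + (e * (2 * L * p) + (M + (K₀ + L * K₂))) + (1 + L * K₁)
          ≡⟨ solve 6 (λ e x M K₀ y z → e :+ (x :+ (M :+ (K₀ :+ z))) :+ (con 1 :+ y)
               := x :+ (con 1 :+ M :+ (K₀ :+ y :+ z :+ e))) refl e (e * (2 * L * p)) M K₀ (L * K₁) (L * K₂) ⟩
        e * (2 * L * p) + (suc M + K) ∎

    bounds : ∀ M → (e * (2 * L * endings X (b ∷ ρ) M) ≤ e * M + (M + K)) ×
                   (e * M ≤ e * (2 * L * endings X (b ∷ ρ) M) + (M + K))
    bounds zero = ≤-trans (≤-reflexive (trans (cong (e *_) (*-zeroʳ (2 * L))) (*-zeroʳ e))) z≤n ,
                  ≤-trans (≤-reflexive (*-zeroʳ e)) z≤n
    bounds (suc M) rewrite endings-∷ X b ρ M =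
      upper M p q p+q≤M density-≤ density-≥ p≤ q≤ , lower M p q p+q≤M density-≤ density-≥ p≤ q≤
      where
      p q : ℕ
      p = continuations X ρ b M
      q = continuations X ρ (not b) M
      split : p + q ≡ endings X ρ M
      split = endings-split X ρ b M
      p+q≤M : p + q ≤ M
      p+q≤M = subst (_≤ M) (sym split) (count-≤ _ M)
      density-≤ : E * (L * (p + q)) ≤ E * M + (M + K₀)
      density-≤ = subst (λ s → E * (L * s) ≤ E * M + (M + K₀)) (sym split) (proj₁ (density M))
      density-≥ : E * M ≤ E * (L * (p + q)) + (M + K₀)
      density-≥ = subst (λ s → E * M ≤ E * (L * s) + (M + K₀)) (sym split) (proj₂ (density M))
      p≤ : E * p ≤ E * q + (q + K₁)
      p≤ = balance₁ M
      q≤ : E * q ≤ E * p + (p + K₂)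
      q≤ = subst (λ a → E * q ≤ E * continuations X ρ a M + (continuations X ρ a M + K₂))
             (Bool.not-involutive b) (balance₂ M)

-- Occurrences as endings of the reversed word

reverseOnto : ∀ {l} → Vec Bool l → List Bool → List Bool
reverseOnto []      ρ = ρ
reverseOnto (a ∷ σ) ρ = reverseOnto σ (a ∷ ρ)

length-reverseOnto : ∀ {l} (σ : Vec Bool l) ρ → length (reverseOnto σ ρ) ≡ l + length ρ
length-reverseOnto []          ρ = refl
length-reverseOnto {suc l} (a ∷ σ) ρ = trans (length-reverseOnto σ (a ∷ ρ)) (+-suc l (length ρ))

-- `ρ` is the part of the word already read before position `i`. Moving the head of `σ` onto `ρ`
-- advances `i` by one, so the induction on `σ` needs both to vary.
endsWith-reverseOnto : ∀ X i {l} (σ : Vec Bool l) ρ →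
  endsWith X (i + l) (reverseOnto σ ρ) ≡ does (≡-dec Bool._≟_ (window X i l) σ) ∧ endsWith X i ρ
endsWith-reverseOnto X i [] ρ = cong (λ j → endsWith X j ρ) (+-identityʳ i)
endsWith-reverseOnto X i {suc l} (a ∷ σ) ρ = begin
  endsWith X (i + suc l) (reverseOnto σ (a ∷ ρ))   ≡⟨ cong (λ j → endsWith X j (reverseOnto σ (a ∷ ρ))) (+-suc i l) ⟩
  endsWith X (suc i + l) (reverseOnto σ (a ∷ ρ))   ≡⟨ endsWith-reverseOnto X (suc i) σ (a ∷ ρ) ⟩
  rest (window X (suc i) l) ∧ ((X i == a) ∧ endsWith X i ρ)
    ≡⟨ Bool.∧-assoc (rest (window X (suc i) l)) (X i == a) (endsWith X i ρ) ⟨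
  (rest (window X (suc i) l) ∧ (X i == a)) ∧ endsWith X i ρ
    ≡⟨ cong (_∧ endsWith X i ρ) (Bool.∧-comm (rest (window X (suc i) l)) (X i == a)) ⟩
  ((X i == a) ∧ rest (window X (suc i) l)) ∧ endsWith X i ρ
    -- The decision for a nonempty vector computes to the conjunction of the decisions for head and
    -- tail, so only the indices `i + 0` and `i + suc j` of the window have to be adjusted.
    ≡⟨ cong (_∧ endsWith X i ρ) (cong₂ (λ j w → (X j == a) ∧ rest w) (sym (+-identityʳ i))
         (tabulate-cong (λ j → cong X (sym (+-suc i (toℕ j)))))) ⟩
  does (≡-dec Bool._≟_ (window X i (suc l)) (a ∷ σ)) ∧ endsWith X i ρ  ∎
  where
  open ≡-Reasoning
  rest : Vec Bool _ → Bool
  rest w = does (≡-dec Bool._≟_ w σ)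

-- An occurrence starting at `i` is an ending at `i + l`, so starts below `n` correspond to endings
-- at the `n` positions from `l` on.
occurrences-endings : ∀ X {l} (σ : Vec Bool l) n →
  endings X (reverseOnto σ []) (n + l) ≡ occurrences X σ n + endings X (reverseOnto σ []) l
occurrences-endings X {l} σ n = trans (count-+ _ n l) (cong (_+ endings X (reverseOnto σ []) l)
  (trans (count-cong (λ i → trans (endsWith-reverseOnto X i σ []) (Bool.∧-identityʳ _)) n)
         (sym (length-filter-upTo (λ i → ≡-dec Bool._≟_ (window X i l) σ) n))))

reciprocalDensity-shift : ∀ L c d s → (∀ n → c (n + s) ≡ d n + c s) → ReciprocalDensity L c → ReciprocalDensity L d
reciprocalDensity-shift L c d s shift density e with density e
-- `e * s + s` pays for the index `n + s` in place of `n`, and `e * (L * c s)` for the count `c s`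
-- before the shift.
... | K , bounds = K + e * s + s + e * (L * c s) , λ n → upper n , lower n
  where
  open ≤-Reasoning
  open +-*-Solver
  upper : ∀ n → e * (L * d n) ≤ e * n + (n + (K + e * s + s + e * (L * c s)))
  upper n = begin
    e * (L * d n)                       ≤⟨ *-monoʳ-≤ e (*-monoʳ-≤ L (m≤m+n (d n) (c s))) ⟩
    e * (L * (d n + c s))               ≡⟨ cong (λ x → e * (L * x)) (shift n) ⟨
    e * (L * c (n + s))                 ≤⟨ proj₁ (bounds (n + s)) ⟩
    e * (n + s) + (n + s + K)           ≤⟨ m≤m+n _ (e * (L * c s)) ⟩
    e * (n + s) + (n + s + K) + e * (L * c s)
      ≡⟨ solve 5 (λ e n s K x → e :* (n :+ s) :+ (n :+ s :+ K) :+ x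
           := e :* n :+ (n :+ (K :+ e :* s :+ s :+ x))) refl e n s K (e * (L * c s)) ⟩
    e * n + (n + (K + e * s + s + e * (L * c s))) ∎
  lower : ∀ n → e * n ≤ e * (L * d n) + (n + (K + e * s + s + e * (L * c s)))
  lower n = begin
    e * n                               ≤⟨ *-monoʳ-≤ e (m≤m+n n s) ⟩
    e * (n + s)                         ≤⟨ proj₂ (bounds (n + s)) ⟩
    e * (L * c (n + s)) + (n + s + K)   ≡⟨ cong (λ x → e * (L * x) + (n + s + K)) (shift n) ⟩
    e * (L * (d n + c s)) + (n + s + K) ≤⟨ m≤m+n _ (e * s) ⟩
    e * (L * (d n + c s)) + (n + s + K) + e * s
      ≡⟨ solve 7 (λ e L x y n s K → e :* (L :* (x :+ y)) :+ (n :+ s :+ K) :+ e :* s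
            := e :* (L :* x) :+ (n :+ (K :+ e :* s :+ s :+ e :* (L :* y)))) refl e L (d n) (c s) n s K ⟩
    e * (L * d n) + (n + (K + e * s + s + e * (L * c s))) ∎

-- Convergence of the frequencies

∣p-q∣<r : ∀ {p q r} → p ℚ.< q ℚ.+ r → q ℚ.< p ℚ.+ r → ℚ.∣ p ℚ.- q ∣ ℚ.< r
∣p-q∣<r {p} {q} {r} p<q+r q<p+r with ℚ.∣p∣≡p∨∣p∣≡-p (p ℚ.- q)
... | inj₁ eq = subst₂ ℚ._<_ (sym eq) (solve 2 (λ q r → q :+ r :- q := r) refl q r) (ℚ.+-monoˡ-< (ℚ.- q) p<q+r)
  where open ℚ-Solver.+-*-Solver
... | inj₂ eq = subst₂ ℚ._<_ (trans (solve 2 (λ p q → q :- p := :- (p :- q)) refl p q) (sym eq))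
                  (solve 2 (λ p r → p :+ r :- p := r) refl p r) (ℚ.+-monoˡ-< (ℚ.- p) q<p+r)
  where open ℚ-Solver.+-*-Solver

-- Let `D` be the denominator of `ε`. At precision `2 * D` and for n > K, the error (n + K)/(2D) is
-- below n/D, so `c n / n` is within 1/(LD) of 1/L. The steps `m≤n*m n L` relax this to 1/D, which
-- is at most `ε`.
reciprocalDensity⇒⟶ : ∀ L c .{{_ : NonZero L}} → ReciprocalDensity L c → (λ n → ℤ.+ c n / n) ⟶ ℤ.+ 1 / L
reciprocalDensity⇒⟶ L c density ε 0<ε with density (2 * ℚ.↧ₙ ε)
... | K , bounds = suc K , close
  where
  open ≤-Reasoning
  open +-*-Solver
  D : ℕ
  D = ℚ.↧ₙ ε

  halve : ∀ n → suc K ≤ n → ∀ {x y} → 2 * x ≤ 2 * y + (n + K) → x < y + n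
  halve n K<n {x} {y} le = *-cancelˡ-< 2 x (y + n) (begin-strict
    2 * x                ≤⟨ le ⟩
    2 * y + (n + K)      <⟨ +-monoʳ-< (2 * y) (+-monoʳ-< n K<n) ⟩
    2 * y + (n + n)      ≡⟨ solve 2 (λ y n → con 2 :* y :+ (n :+ n) := con 2 :* (y :+ n)) refl y n ⟩
    2 * (y + n)          ∎)

  close : ∀ n .{{_ : NonZero n}} → suc K ≤ n → ℚ.∣ ℤ.+ c n / n ℚ.- ℤ.+ 1 / L ∣ ℚ.< ε
  close n K<n = ∣p-q∣<r
    (ℚ.<-≤-trans (subst (ℤ.+ c n / n ℚ.<_) (sym (/-+ 1 L 1 D))
        (/-mono-< (c n) n (1 * D + 1 * L) (L * D) (begin-strict
          c n * (L * D)            ≡⟨ solve 3 (λ c L D → c :* (L :* D) := D :* (L :* c)) refl (c n) L D ⟩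
          D * (L * c n)            <⟨ halve n K<n (subst₂ (λ x y → x ≤ y + (n + K)) (*-assoc 2 D (L * c n)) (*-assoc 2 D n) (proj₁ (bounds n))) ⟩
          D * n + n                ≤⟨ +-monoʳ-≤ (D * n) (m≤n*m n L) ⟩
          D * n + L * n
            ≡⟨ solve 3 (λ D L n → D :* n :+ L :* n := (con 1 :* D :+ con 1 :* L) :* n) refl D L n ⟩
          (1 * D + 1 * L) * n      ∎)))
      (ℚ.+-monoʳ-≤ (ℤ.+ 1 / L) (1/denominator≤ 0<ε)))
    (ℚ.<-≤-trans (subst (ℤ.+ 1 / L ℚ.<_) (sym (/-+ (c n) n 1 D))
        (/-mono-< 1 L (c n * D + 1 * n) (n * D) (begin-strict
          1 * (n * D)              ≡⟨ solve 2 (λ n D → con 1 :* (n :* D) := D :* n) refl n D ⟩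
          D * n                    <⟨ halve n K<n (subst₂ (λ x y → x ≤ y + (n + K)) (*-assoc 2 D n) (*-assoc 2 D (L * c n)) (proj₂ (bounds n))) ⟩
          D * (L * c n) + n        ≤⟨ +-monoʳ-≤ (D * (L * c n)) (m≤n*m n L) ⟩
          D * (L * c n) + L * n
            ≡⟨ solve 4 (λ D L c n → D :* (L :* c) :+ L :* n := (c :* D :+ con 1 :* n) :* L) refl D L (c n) n ⟩
          (c n * D + 1 * n) * L    ∎)))
      (ℚ.+-monoʳ-≤ (ℤ.+ c n / n) (1/denominator≤ 0<ε)))
    where
    instance
      L*D≢0 : NonZero (L * D)
      L*D≢0 = m*n≢0 L D
      n*D≢0 : NonZero (n * D)
      n*D≢0 = m*n≢0 n D

theorem3p3 : ExcludedMiddle 0ℓ → (X : Cantor) → Random X → Normal X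
theorem3p3 em X random l σ = reciprocalDensity⇒⟶ (2 ^ l) (occurrences X σ) {{m^n≢0 2 l}}
  (reciprocalDensity-shift (2 ^ l) (endings X ρ) (occurrences X σ) l (occurrences-endings X σ)
    (subst (λ k → ReciprocalDensity (2 ^ k) (endings X ρ))
      (trans (length-reverseOnto σ []) (+-identityʳ l))
      (endings-density em X random ρ)))
  where
  ρ : List Bool
  ρ = reverseOnto σ []
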